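{- Let $G$ be a simple graph with vertex set $[\ell]=\{1,\dots,\ell\}$, and for $i=0,1,\dots,\ell-1$ let $$f_i(G)=\sum_{W\subset[\ell],\ \#W=\ell-i}c(G[W]),$$ where $c(G[W])$ is the number of connected components of the induced subgraph $G[W]$ of $G$ on $W$. Then $$\mathrm{Hilb}\big(D(\mathcal{A}_G),t\big)=\sum_{i=0}^{\ell-1}f_i(G)\frac{t^i}{(1-t)^{i+1}}.$$
   Context: Let $\mathbb{K}$ be a field and $S=\mathbb{K}[x_1,\dots,x_\ell]$ with $\deg x_i=1$, the coordinate ring of $\mathbb{K}^\ell$. For a simple graph $G$ with vertex set $[\ell]$ and edge set $E(G)$, the graphic arrangement is $\mathcal{A}_G=\{\{x_u=x_v\}\mid\{u,v\}\in E(G)\}$. Let $\mathrm{Der}(S)=\bigoplus_{i=1}^\ell S\,\partial_{x_i}$. For an arrangement $\mathcal{A}$ of linear hyperplanes $H$ with defining linear forms $\alpha_H$, the logarithmic vector field module is $$D(\mathcal{A})=\{\theta\in\mathrm{Der}(S)\mid\theta(\alpha_H)\in(\alpha_H)\text{ for all }H\in\mathcal{A}\},$$ graded by $\deg(\partial_{x_i})=0$. For a graded module $M=\bigoplus_{i\in\mathbb{Z}}M_i$, $\mathrm{Hilb}(M,t)=\sum_{i\in\mathbb{Z}}(\dim_{\mathbb{K}}M_i)t^i$. -}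

module Defs where

open import Level using (0ℓ; _⊔_) renaming (suc to lsuc)
open import Algebra.Bundles using (CommutativeRing; Ring)
open import Algebra.Apartness.Bundles using (HeytingField)
open import Algebra.Module.Bundles using (LeftModule)
open import Data.Bool.Base using (if_then_else_; true; false)
open import Data.Fin.Base using (Fin; zero; suc; toℕ; punchIn; punchOut)
import Data.Fin.Properties as Fin
import Algebra.Properties.Ring as RingProperties
open import Data.Fin.Subset using (Subset; _∈_; ∣_∣; inside; outside)
open import Data.Integer.Base as ℤ using (ℤ; +_; 0ℤ; 1ℤ; -1ℤ)
import Data.Integer.Properties as ℤ
open import Data.List.Base as List using (List; []; _∷_; _++_)
open import Data.List.Membership.Propositional using () renaming (_∈_ to _∈ₗ_)
import Data.List.Membership.Propositional.Properties as ∈ₗ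
open import Data.List.Relation.Unary.Any using (here; there)
open import Data.Nat.Base as ℕ using (ℕ; zero; suc; _∸_)
import Data.Nat.Properties as ℕ
open import Data.Nat.ListAction using () renaming (sum to sumᴺ)
open import Data.Product.Base
  using (Σ; ∃; ∃₂; ∃-syntax; _×_; _,_; proj₁; proj₂; uncurry)
open import Data.Sum.Base using (_⊎_; inj₁; inj₂)
open import Data.Vec.Base as Vec using (Vec; []; _∷_)
open import Data.Vec.Functional using (Vector; foldr)
import Data.Vec.Properties as Vec
open import Function.Base using (_∘_; _on_)
open import Function.Bundles using (_⇔_; mk⇔; module Equivalence)
open import Function.Definitions using (StrictlySurjective)
open import Relation.Binary.Construct.Closure.Equivalence as Eq using (EqClosure)
open import Relation.Binary.Construct.Closure.ReflexiveTransitive as Star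
  using (Star; ε)
open import Relation.Binary.Construct.Closure.Symmetric using (fwd; bwd)
open import Relation.Binary.Core using (Rel)
open import Relation.Binary.Definitions using (Symmetric; Decidable)
open import Relation.Binary.PropositionalEquality
  using (_≡_; _≢_; _≗_; refl; sym; trans; cong; subst; isEquivalence)
open import Relation.Nullary using (¬_; yes; no; does; contradiction)
open import Relation.Unary using (Pred; _∩_) renaming (_∈_ to _∈ₚ_)

record SimpleGraph (V : Set) : Set₁ where
  field
    Adj        : Rel V 0ℓ
    adj-sym    : Symmetric Adj
    adj-irrefl : ∀ {v} → ¬ Adj v v
    adj?       : Decidable Adj

  -- Adj is symmetric, so this is already an equivalence relation.
  Connected : Rel V 0ℓ
  Connected = Star Adj

induced : ∀ {n} → SimpleGraph (Fin n) → (W : Subset n) →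
          SimpleGraph (∃[ v ] v ∈ W)
induced G W = record
  { Adj        = Adj on proj₁
  ; adj-sym    = adj-sym
  ; adj-irrefl = adj-irrefl
  ; adj?       = λ u v → adj? (proj₁ u) (proj₁ v)
  }
  where open SimpleGraph G

-- Fin n is a quotient of V by the equivalence relation R, i.e. R has
-- exactly n equivalence classes.  For R = _≡_ this says that V has n elements.
HasClassCount : ∀ {V : Set} → Rel V 0ℓ → ℕ → Set
HasClassCount {V} R n =
  Σ (V → Fin n) λ κ →
    StrictlySurjective _≡_ κ × (∀ u v → κ u ≡ κ v ⇔ R u v)

HasComponentCount : ∀ {V} → SimpleGraph V → ℕ → Set
HasComponentCount G = HasClassCount (SimpleGraph.Connected G)

private
  module Merge {n} {a b : Fin (suc n)} (a≢b : a ≢ b) where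

    merge : Fin (suc n) → Fin n
    merge x with a Fin.≟ x
    ... | yes _  = punchOut a≢b
    ... | no a≢x = punchOut a≢x

    merge-surjective : StrictlySurjective _≡_ merge
    merge-surjective y = punchIn a y , eq
      where
      eq : merge (punchIn a y) ≡ y
      eq with a Fin.≟ punchIn a y
      ... | yes a≡ = contradiction (sym a≡) (Fin.punchInᵢ≢i a y)
      ... | no _   = trans (Fin.punchOut-cong a refl) (Fin.punchOut-punchIn a)

    merge-identifies : merge a ≡ merge b
    merge-identifies with a Fin.≟ a | a Fin.≟ b
    ... | no a≢a | _       = contradiction refl a≢a
    ... | yes _  | yes a≡b = contradiction a≡b a≢b
    ... | yes _  | no _    = Fin.punchOut-cong a refl

    merge-kernel : ∀ x y → merge x ≡ merge y →
                   x ≡ y ⊎ (x ≡ a × y ≡ b) ⊎ (x ≡ b × y ≡ a)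
    merge-kernel x y eq with a Fin.≟ x | a Fin.≟ y
    ... | yes a≡x | yes a≡y = inj₁ (trans (sym a≡x) a≡y)
    ... | yes a≡x | no a≢y  =
      inj₂ (inj₁ (sym a≡x , sym (Fin.punchOut-injective a≢b a≢y eq)))
    ... | no a≢x  | yes a≡y =
      inj₂ (inj₂ (Fin.punchOut-injective a≢x a≢b eq , sym a≡y))
    ... | no a≢x  | no a≢y  = inj₁ (Fin.punchOut-injective a≢x a≢y eq)

  -- Start from one class per element and merge the classes of the endpoints
  -- of each listed pair in turn.
  ListRel : ∀ {V : Set} → List (V × V) → Rel V 0ℓ
  ListRel L u v = (u , v) ∈ₗ L

  closureClassCount : ∀ {V : Set} {m} → HasClassCount {V} _≡_ m →
                      ∀ L → ∃[ n ] HasClassCount (EqClosure (ListRel {V} L)) n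
  closureClassCount {m = m} (κ , surj , ker) [] =
    m , κ , surj , λ u v → mk⇔
      (λ eq → subst (EqClosure _ u) (Equivalence.to (ker u v) eq) ε)
      (λ r → Equivalence.from (ker u v) (Eq.fold isEquivalence (λ ()) r))
  closureClassCount {V} base ((p , q) ∷ L)
    with closureClassCount base L
  ... | zero , κ , _ = contradiction (κ p) λ ()
  ... | suc n , κ , surj , ker with κ p Fin.≟ κ q
  ...   | yes κp≡κq = suc n , κ , surj , λ u v → mk⇔
            (Eq.map there ∘ Equivalence.to (ker u v))
            (Eq.gfold isEquivalence κ
              λ { (here refl) → κp≡κq
                ; (there r)   → Equivalence.from (ker _ _) (Eq.return r) })
  ...   | no κp≢κq = n , merge ∘ κ , surj′ , λ u v → mk⇔
            (λ eq → fromMerge u v (merge-kernel (κ u) (κ v) eq))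
            (Eq.gfold isEquivalence (merge ∘ κ)
              λ { (here refl) → merge-identifies
                ; (there r)   →
                    cong merge (Equivalence.from (ker _ _) (Eq.return r)) })
    where
    open Merge κp≢κq

    R′ = ListRel ((p , q) ∷ L)

    surj′ : StrictlySurjective _≡_ (merge ∘ κ)
    surj′ y with merge-surjective y
    ... | x , refl with surj x
    ...   | v , refl = v , refl

    old : ∀ u v → κ u ≡ κ v → EqClosure R′ u v
    old u v = Eq.map there ∘ Equivalence.to (ker u v)

    new : EqClosure R′ p q
    new = Eq.return (here refl)

    fromMerge : ∀ u v → κ u ≡ κ v ⊎ (κ u ≡ κ p × κ v ≡ κ q)
                                  ⊎ (κ u ≡ κ q × κ v ≡ κ p) →
                EqClosure R′ u v
    fromMerge u v (inj₁ eq) = old u v eq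
    fromMerge u v (inj₂ (inj₁ (up , vq))) =
      Eq.transitive R′ (old u p up)
        (Eq.transitive R′ new (old q v (sym vq)))
    fromMerge u v (inj₂ (inj₂ (uq , vp))) =
      Eq.transitive R′ (old u q uq)
        (Eq.transitive R′ (Eq.symmetric R′ new) (old p v (sym vp)))

  componentCount : ∀ {V m} → HasClassCount {V} _≡_ m →
                   (G : SimpleGraph V) → ∃ (HasComponentCount G)
  componentCount {V} {m} base@(κ , surj , ker) G =
    let n , κ′ , surj′ , ker′ = closureClassCount base edges in
    n , κ′ , surj′ , λ u v → mk⇔
      (Star.map edge⇒adj ∘ Equivalence.to (ker′ u v))
      (Equivalence.from (ker′ u v) ∘ Star.map (fwd ∘ adj⇒edge))
    where
    open SimpleGraph G

    vertices : List V
    vertices = List.map (proj₁ ∘ surj) (List.allFin m)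

    ∈vertices : ∀ v → v ∈ₗ vertices
    ∈vertices v = subst (_∈ₗ vertices)
      (Equivalence.to (ker _ v) (proj₂ (surj (κ v))))
      (∈ₗ.∈-map⁺ (proj₁ ∘ surj) (∈ₗ.∈-allFin (κ v)))

    edges : List (V × V)
    edges = List.filter (uncurry adj?) (List.cartesianProduct vertices vertices)

    adj⇒edge : ∀ {u v} → Adj u v → ListRel edges u v
    adj⇒edge {u} {v} uv = ∈ₗ.∈-filter⁺ (uncurry adj?)
      (∈ₗ.∈-cartesianProduct⁺ (∈vertices u) (∈vertices v)) uv

    listed⇒adj : ∀ {u v} → ListRel edges u v → Adj u v
    listed⇒adj =
      proj₂ ∘ ∈ₗ.∈-filter⁻ (uncurry adj?) {xs = List.cartesianProduct vertices vertices}

    edge⇒adj : ∀ {u v} → _ → Adj u v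
    edge⇒adj (fwd uv) = listed⇒adj uv
    edge⇒adj (bwd vu) = adj-sym (listed⇒adj vu)

  subsetSize : ∀ {n} (W : Subset n) → HasClassCount {∃[ v ] v ∈ W} _≡_ ∣ W ∣
  subsetSize [] = (λ ()) , (λ ()) , λ ()
  subsetSize (outside ∷ W) with subsetSize W
  ... | κ , surj , ker = κ′ , surj′ , ker′
    where
    κ′ : ∃[ v ] v ∈ (outside ∷ W) → Fin ∣ W ∣
    κ′ (suc v , Vec.there v∈) = κ (v , v∈)
    surj′ : StrictlySurjective _≡_ κ′
    surj′ y = let (v , v∈) , eq = surj y in (suc v , Vec.there v∈) , eq
    ker′ : ∀ u v → κ′ u ≡ κ′ v ⇔ u ≡ v
    ker′ (suc u , Vec.there u∈) (suc v , Vec.there v∈) = mk⇔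
      (λ eq → cong (λ { (w , w∈) → suc w , Vec.there w∈ })
                   (Equivalence.to (ker (u , u∈) (v , v∈)) eq))
      (cong κ′)
  subsetSize (inside ∷ W) with subsetSize W
  ... | κ , surj , ker = κ′ , surj′ , ker′
    where
    κ′ : ∃[ v ] v ∈ (inside ∷ W) → Fin (suc ∣ W ∣)
    κ′ (zero  , Vec.here)     = zero
    κ′ (suc v , Vec.there v∈) = suc (κ (v , v∈))
    surj′ : StrictlySurjective _≡_ κ′
    surj′ zero    = (zero , Vec.here) , refl
    surj′ (suc y) =
      let (v , v∈) , eq = surj y in (suc v , Vec.there v∈) , cong suc eq
    ker′ : ∀ u v → κ′ u ≡ κ′ v ⇔ u ≡ v
    ker′ (zero , Vec.here) (zero , Vec.here) = mk⇔ (λ _ → refl) (λ _ → refl)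
    ker′ (zero , Vec.here) (suc v , Vec.there v∈) = mk⇔ (λ ()) (λ ())
    ker′ (suc u , Vec.there u∈) (zero , Vec.here) = mk⇔ (λ ()) (λ ())
    ker′ (suc u , Vec.there u∈) (suc v , Vec.there v∈) = mk⇔
      (λ eq → cong (λ { (w , w∈) → suc w , Vec.there w∈ })
                   (Equivalence.to (ker (u , u∈) (v , v∈))
                                   (Fin.suc-injective eq)))
      (cong κ′)

c : ∀ {n} → SimpleGraph (Fin n) → Subset n → ℕ
c G W = proj₁ (componentCount (subsetSize W) (induced G W))

c-correct : ∀ {n} (G : SimpleGraph (Fin n)) W →
            HasComponentCount (induced G W) (c G W)
c-correct G W = proj₂ (componentCount (subsetSize W) (induced G W))

subsets : ∀ n → List (Subset n)
subsets zero    = [] ∷ []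
subsets (suc n) =
  List.map (outside ∷_) (subsets n) ++ List.map (inside ∷_) (subsets n)

f : ∀ {n} → SimpleGraph (Fin n) → ℕ → ℕ
f {n} G i =
  sumᴺ (List.map (c G) (List.filter (λ W → ∣ W ∣ ℕ.≟ n ∸ i) (subsets n)))

module PowerSeries where

  open import Algebra.Properties.CommutativeMonoid.Sum ℤ.+-0-commutativeMonoid
    using (sum)

  ℤ⟦t⟧ : Set
  ℤ⟦t⟧ = ℕ → ℤ

  infixr 8 _^_
  infixl 7 _*_ _·_

  one t 1-t : ℤ⟦t⟧
  one zero    = 1ℤ
  one (suc _) = 0ℤ
  t zero    = 0ℤ
  t (suc n) = one n
  1-t n = one n ℤ.- t n

  _·_ : ℤ → ℤ⟦t⟧ → ℤ⟦t⟧
  (a · p) n = a ℤ.* p n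

  _*_ : ℤ⟦t⟧ → ℤ⟦t⟧ → ℤ⟦t⟧
  (p * q) n = sum {suc n} λ k → p (toℕ k) ℤ.* q (n ∸ toℕ k)

  _^_ : ℤ⟦t⟧ → ℕ → ℤ⟦t⟧
  p ^ zero  = one
  p ^ suc n = p * p ^ n

  -- The geometric series; 1/[1-t]-inverse shows it is the inverse of 1 - t.
  1/[1-t] : ℤ⟦t⟧
  1/[1-t] _ = 1ℤ

  1/[1-t]-inverse : 1-t * 1/[1-t] ≗ one
  1/[1-t]-inverse zero    = refl
  1/[1-t]-inverse (suc n) = cong (λ z → 1ℤ ℤ.+ (-1ℤ ℤ.+ z)) (zeros n)
    where
    zeros : ∀ k → sum {k} (λ _ → 0ℤ) ≡ 0ℤ
    zeros zero    = refl
    zeros (suc k) = trans (ℤ.+-identityˡ _) (zeros k)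

  sum-series : ∀ n → (Fin n → ℤ⟦t⟧) → ℤ⟦t⟧
  sum-series n p d = sum λ i → p i d

  infixl 6 sum-series
  syntax sum-series n (λ i → p) = ∑[ i < n ] p

module _ {r ℓr m ℓm} {R : Ring r ℓr} (V : LeftModule R m ℓm) where

  open Ring R using (Carrier; _≈_; 0#)
  open LeftModule V
  open import Algebra.Properties.CommutativeMonoid.Sum +ᴹ-commutativeMonoid
    using (sum)

  -- P is meant to be a subspace; b is then a basis of P.
  record IsBasis {p} (P : Pred Carrierᴹ p) {n} (b : Vector Carrierᴹ n)
         : Set (r ⊔ ℓr ⊔ m ⊔ ℓm ⊔ p) where
    field
      member      : ∀ i → b i ∈ₚ P
      independent : ∀ (a : Vector Carrier n) →
                    sum (λ i → a i *ₗ b i) ≈ᴹ 0ᴹ → ∀ i → a i ≈ 0#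
      spanning    : ∀ {v} → v ∈ₚ P →
                    ∃ λ (a : Vector Carrier n) → v ≈ᴹ sum (λ i → a i *ₗ b i)

  HasDimension : ∀ {p} → Pred Carrierᴹ p → ℕ → Set (r ⊔ ℓr ⊔ m ⊔ ℓm ⊔ p)
  HasDimension P n = Σ (Vector Carrierᴹ n) (IsBasis P)

module Logarithmic {k ℓ₁ ℓ₂} (K : HeytingField k ℓ₁ ℓ₂) (ℓ : ℕ) where

  -- For the apartness ¬ x ≈ y a Heyting field is, classically, exactly a field.
  private
    commutativeRing : CommutativeRing k ℓ₁
    commutativeRing = record
      { isCommutativeRing = HeytingField.isCommutativeRing K }

  open CommutativeRing commutativeRing
    using (Carrier; _≈_; _+_; _*_; -_; 0#; 1#; ring; +-rawMonoid;
           +-cong; +-congˡ; +-identityˡ; +-identityʳ; +-assoc; +-comm;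
           *-congˡ; *-cong; *-identityˡ; *-assoc; zeroˡ; zeroʳ;
           distribˡ; distribʳ; -‿cong; -‿inverseˡ; -‿inverseʳ)
    renaming (refl to ≈-refl; sym to ≈-sym; trans to ≈-trans)
  open import Algebra.Definitions.RawMonoid +-rawMonoid
    using () renaming (_×_ to _×ᴷ_)

  -- An exponent vector.
  Monomial : Set
  Monomial = Vec ℕ ℓ

  -- Formal sums of terms a x^m.  Repeated monomials and zero coefficients
  -- are allowed; _≈ˢ_ is the equality of polynomials.
  S : Set k
  S = List (Carrier × Monomial)

  coeff : S → Monomial → Carrier
  coeff []            m = 0#
  coeff ((a , n) ∷ p) m =
    (if does (Vec.≡-dec ℕ._≟_ n m) then a else 0#) + coeff p m

  infix  4 _≈ˢ_ _∈⟨_⟩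
  infixl 6 _+ˢ_
  infixl 7 _*ˢ_ _·ˢ_
  infix  8 -ˢ_

  _≈ˢ_ : Rel S ℓ₁
  p ≈ˢ q = ∀ m → coeff p m ≈ coeff q m

  0ˢ : S
  0ˢ = []

  _+ˢ_ _*ˢ_ : S → S → S
  _+ˢ_ = _++_
  _*ˢ_ = List.cartesianProductWith
    λ (a , m) (b , n) → a * b , Vec.zipWith ℕ._+_ m n

  -ˢ_ : S → S
  -ˢ_ = List.map λ (a , m) → - a , m

  _·ˢ_ : Carrier → S → S
  a ·ˢ p = List.map (λ (b , m) → a * b , m) p

  x : Fin ℓ → S
  x i = (1# , Vec.replicate ℓ 0 Vec.[ i ]≔ 1) ∷ []

  -- In the term with exponent 0 the truncated predecessor is harmless: the
  -- coefficient becomes 0.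
  ∂ : Fin ℓ → S → S
  ∂ i = List.map λ (a , m) → Vec.lookup m i ×ᴷ a , m Vec.[ i ]%= ℕ.pred

  IsHomogeneous : ℕ → Pred S ℓ₁
  IsHomogeneous d p = ∀ m → Vec.sum m ≢ d → coeff p m ≈ 0#

  _∈⟨_⟩ : S → S → Set (k ⊔ ℓ₁)
  p ∈⟨ g ⟩ = ∃ λ q → p ≈ˢ q *ˢ g

  -- θ stands for ∑ᵢ θ i ∂ᵢ.
  Der : Set k
  Der = Vector S ℓ

  _⟪_⟫ : Der → S → S
  θ ⟪ p ⟫ = foldr _+ˢ_ 0ˢ λ i → θ i *ˢ ∂ i p

  -- deg ∂ᵢ = 0
  DerDegree : ℕ → Pred Der ℓ₁
  DerDegree d θ = ∀ i → IsHomogeneous d (θ i)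

  coeff-+ : ∀ p q m → coeff (p +ˢ q) m ≈ coeff p m + coeff q m
  coeff-+ []      q m = ≈-sym (+-identityˡ _)
  coeff-+ (_ ∷ p) q m =
    ≈-trans (+-congˡ (coeff-+ p q m)) (≈-sym (+-assoc _ _ _))

  coeff-· : ∀ a p m → coeff (a ·ˢ p) m ≈ a * coeff p m
  coeff-· a []            m = ≈-sym (zeroʳ a)
  coeff-· a ((b , n) ∷ p) m with does (Vec.≡-dec ℕ._≟_ n m)
  ... | true  =
    ≈-trans (+-congˡ (coeff-· a p m)) (≈-sym (distribˡ a b _))
  ... | false =
    ≈-trans (+-cong (≈-sym (zeroʳ a)) (coeff-· a p m)) (≈-sym (distribˡ a 0# _))

  open RingProperties ring using (-0#≈0#; -‿+-comm)

  coeff-neg : ∀ p m → coeff (-ˢ p) m ≈ - coeff p m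
  coeff-neg []            m = ≈-sym -0#≈0#
  coeff-neg ((b , n) ∷ p) m with does (Vec.≡-dec ℕ._≟_ n m)
  ... | true  =
    ≈-trans (+-congˡ (coeff-neg p m)) (-‿+-comm b _)
  ... | false =
    ≈-trans (+-cong (≈-sym -0#≈0#) (coeff-neg p m)) (-‿+-comm 0# _)

  -- Der(S) as a K-vector space.
  DerModule : LeftModule ring k ℓ₁
  DerModule = record
    { Carrierᴹ = Der
    ; _≈ᴹ_ = λ θ η → ∀ i → θ i ≈ˢ η i
    ; _+ᴹ_ = λ θ η i → θ i +ˢ η i
    ; _*ₗ_ = λ a θ i → a ·ˢ θ i
    ; 0ᴹ = λ _ → 0ˢ
    ; -ᴹ_ = λ θ i → -ˢ θ i
    ; isLeftModule = record
      { isLeftSemimodule = record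
        { +ᴹ-isCommutativeMonoid = record
          { isMonoid = record
            { isSemigroup = record
              { isMagma = record
                { isEquivalence = record
                  { refl  = λ _ _ → ≈-refl
                  ; sym   = λ e i m → ≈-sym (e i m)
                  ; trans = λ e e′ i m → ≈-trans (e i m) (e′ i m)
                  }
                ; ∙-cong = λ {θ} {θ′} {η} {η′} e e′ i m →
                    ≈-trans (coeff-+ (θ i) (η i) m)
                    (≈-trans (+-cong (e i m) (e′ i m))
                             (≈-sym (coeff-+ (θ′ i) (η′ i) m)))
                }
              ; assoc = λ θ η ζ i m →
                  ≈-trans (coeff-+ (θ i +ˢ η i) (ζ i) m)
                  (≈-trans (+-cong (coeff-+ (θ i) (η i) m) ≈-refl)
                  (≈-trans (+-assoc _ _ _)
                  (≈-trans (+-congˡ (≈-sym (coeff-+ (η i) (ζ i) m)))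
                           (≈-sym (coeff-+ (θ i) (η i +ˢ ζ i) m)))))
              }
            ; identity = (λ _ _ _ → ≈-refl)
                       , (λ θ i m → ≈-trans (coeff-+ (θ i) 0ˢ m) (+-identityʳ _))
            }
          ; comm = λ θ η i m →
              ≈-trans (coeff-+ (θ i) (η i) m)
              (≈-trans (+-comm _ _) (≈-sym (coeff-+ (η i) (θ i) m)))
          }
        ; isPreleftSemimodule = record
          { *ₗ-cong = λ {a} {b} {θ} {η} a≈b e i m →
              ≈-trans (coeff-· a (θ i) m)
              (≈-trans (*-cong a≈b (e i m)) (≈-sym (coeff-· b (η i) m)))
          ; *ₗ-zeroˡ = λ θ i m → ≈-trans (coeff-· 0# (θ i) m) (zeroˡ _)
          ; *ₗ-distribʳ = λ θ a b i m →
              ≈-trans (coeff-· (a + b) (θ i) m)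
              (≈-trans (distribʳ _ a b)
              (≈-trans (≈-sym (+-cong (coeff-· a (θ i) m) (coeff-· b (θ i) m)))
                       (≈-sym (coeff-+ (a ·ˢ θ i) (b ·ˢ θ i) m))))
          ; *ₗ-identityˡ = λ θ i m → ≈-trans (coeff-· 1# (θ i) m) (*-identityˡ _)
          ; *ₗ-assoc = λ a b θ i m →
              ≈-trans (coeff-· (a * b) (θ i) m)
              (≈-trans (*-assoc a b _)
              (≈-trans (*-congˡ (≈-sym (coeff-· b (θ i) m)))
                       (≈-sym (coeff-· a (b ·ˢ θ i) m))))
          ; *ₗ-zeroʳ = λ _ _ _ → ≈-refl
          ; *ₗ-distribˡ = λ a θ η i m →
              ≈-trans (coeff-· a (θ i +ˢ η i) m)
              (≈-trans (*-congˡ (coeff-+ (θ i) (η i) m))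
              (≈-trans (distribˡ a _ _)
              (≈-trans (≈-sym (+-cong (coeff-· a (θ i) m) (coeff-· a (η i) m)))
                       (≈-sym (coeff-+ (a ·ˢ θ i) (a ·ˢ η i) m)))))
          }
        }
      ; -ᴹ‿cong = λ {θ} {η} e i m →
          ≈-trans (coeff-neg (θ i) m)
          (≈-trans (-‿cong (e i m)) (≈-sym (coeff-neg (η i) m)))
      ; -ᴹ‿inverse =
          (λ θ i m → ≈-trans (coeff-+ (-ˢ θ i) (θ i) m)
                     (≈-trans (+-cong (coeff-neg (θ i) m) ≈-refl) (-‿inverseˡ _)))
        , (λ θ i m → ≈-trans (coeff-+ (θ i) (-ˢ θ i) m)
                     (≈-trans (+-congˡ (coeff-neg (θ i) m)) (-‿inverseʳ _)))
      }
    }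

  -- An arrangement is given by a family of linear forms defining its
  -- hyperplanes.  D makes sense for any family of polynomials, so linearity
  -- is not recorded in the type.  Listing a hyperplane more than once, with
  -- proportional forms (as graphicArrangement does, once per orientation of
  -- an edge), does not change D.
  Arrangement : Set (lsuc 0ℓ ⊔ k)
  Arrangement = Σ Set λ I → I → S

  graphicArrangement : SimpleGraph (Fin ℓ) → Arrangement
  graphicArrangement G = (∃₂ λ u v → Adj u v) , λ (u , v , _) → x u +ˢ -ˢ x v
    where open SimpleGraph G

  D : Arrangement → Pred Der (k ⊔ ℓ₁)
  D (I , α) θ = ∀ (H : I) → θ ⟪ α H ⟫ ∈⟨ α H ⟩

  -- Degrees of polynomials are natural numbers, so Der(S) has no components
  -- of negative degree and the Hilbert series is a power series.
  HasHilbertSeries : ∀ {p} → Pred Der p → PowerSeries.ℤ⟦t⟧ → Set (k ⊔ ℓ₁ ⊔ p)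
  HasHilbertSeries M h =
    ∀ d → ∃[ n ] HasDimension DerModule (M ∩ DerDegree d) n × h d ≡ + n

{-# OPTIONS --safe #-}
module Submission where

-- Let ψ : S → T = K[z, y₁, …, y_ℓ] send x_w to z − y_w, and φ_v : T → S send z to x_v
-- and y_w to x_v − x_w.  Then φ_v ∘ ψ = id and ψ ∘ φ_v = id modulo y_v, so θ_v is
-- determined by the coefficients of ψ(θ_v) at the monomials not involving y_v.  As
-- ψ(x_u − x_v) = y_v − y_u, a derivation θ is logarithmic for u — v exactly when ψ(θ_u) and
-- ψ(θ_v) agree at the monomials involving neither y_u nor y_v.  So, for each monomial z^b y^a,
-- the coefficients of the ψ(θ_v) there form a function on W = { v ∣ a_v = 0 } which is
-- constant on the components of G[W].  Hence the degree d part of D(𝒜_G) has a basis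
-- indexed by the pairs of an a with |a| ≤ d (and then b = d − |a|) and a component of G[W].
-- There are d C (ℓ − #W) such a for each W, and d C i is the coefficient of t^d in
-- t^i / (1 − t)^{i+1}.

open import Defs
open import Algebra.Apartness.Bundles using (HeytingField)
open import Algebra.Bundles using (CommutativeRing; CommutativeSemiring)
open import Algebra.Module.Bundles using (LeftModule)
import Algebra.Morphism.Construct.Identity as Identity
open import Algebra.Morphism.Structures using (module RingMorphisms)
import Algebra.Properties.Semiring.Exp
open import Data.Bool.Base using (if_then_else_; true; false)
open import Data.Fin.Base using (Fin; zero; suc; toℕ; fromℕ<)
import Data.Fin.Properties as Fin
open import Data.Fin.Subset using (Subset; Side; inside; outside; ∣_∣; _∈_; _∉_)
import Data.Fin.Subset.Properties as Subset
open import Data.Integer.Base as ℤ using (ℤ; +_; 0ℤ; 1ℤ)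
import Data.Integer.Properties as ℤ
open import Data.List.Base as List using (List; []; _∷_; _++_; allFin)
import Data.List.Membership.DecPropositional as DecMembership
open import Data.List.Membership.Propositional using (find) renaming (_∈_ to _∈ₗ_; _∉_ to _∉ₗ_)
import Data.List.Membership.Propositional.Properties as ∈ₗ
import Data.List.Properties as List
open import Data.List.Relation.Unary.All as All using (All; []; _∷_)
import Data.List.Relation.Unary.All.Properties as All
open import Data.List.Relation.Unary.AllPairs as AllPairs using ([]; _∷_)
import Data.List.Relation.Unary.AllPairs.Properties as AllPairs
open import Data.List.Relation.Unary.Any using (here; there)
open import Data.List.Relation.Unary.Unique.Propositional using (Unique)
import Data.List.Relation.Unary.Unique.Propositional.Properties as Unique
open import Data.Nat.Base as ℕ using (ℕ; zero; suc; _∸_; _≤_; _<_; z≤n; s≤s)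
open import Data.Nat.Combinatorics using (_C_; nCn≡1; nCk+nC[k+1]≡[n+1]C[k+1]; k>n⇒nCk≡0)
import Data.Nat.Properties as ℕ
open import Data.Product.Base using (∃; _×_; _,_; proj₁; proj₂)
open import Data.Sum.Base using (inj₁; inj₂)
open import Data.Vec.Base as Vec using (Vec; []; _∷_; here; there)
import Data.Vec.Properties as Vec
import Data.Vec.Properties.WithK as Vec
open import Function.Base using (_∘_; id)
open import Function.Bundles using (Equivalence)
open import Level using (Level; _⊔_)
open import Relation.Binary.Bundles using (Setoid)
open import Relation.Binary.Construct.Closure.ReflexiveTransitive using (Star; ε; _◅_)
open import Relation.Binary.PropositionalEquality as ≡ using (_≡_; _≢_; _≗_)
open import Relation.Binary.Structures using (IsEquivalence)
open import Relation.Nullary using (¬_; does; Dec; yes; no; contradiction)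
open import Relation.Nullary.Decidable using (¬?; dec-true; dec-false)
open import Relation.Unary using (Pred; Decidable; _∩_)

-- The obstacle is that the ideals (x_u - x_v) are not monomial: already for a triangle the three
-- forms are linearly dependent, so no linear change of coordinates in S makes all of them
-- variables. The extra variable z treats all vertices alike. After ψ the ideal of an edge lies in
-- the monomial ideal (y_u, y_v), where membership is read off coefficients. That nothing is lost by
-- this weakening is shown by explicit vectors. The one for a and a component C of G[W] has, with b
-- = d - |a|, the entry x_v^b ∏_w (x_v - x_w)^(a_w) at v in C and 0 elsewhere, and it is
-- logarithmic. Its dual functional reads the coefficient of z^b y^a in ψ(θ_v) at one chosen v in C.
-- With vectors and functionals both explicit, independence and spanning are computations that never
-- test a scalar for zero; equality in a Heyting field is not assumed decidable.

lookup-injective : ∀ {a} {A : Set a} {xs : List A} → Unique xs → ∀ i j →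
                   List.lookup xs i ≡ List.lookup xs j → i ≡ j
lookup-injective {xs = _ ∷ _} _ zero    zero    _  = ≡.refl
lookup-injective {xs = _ ∷ _} u zero    (suc j) eq =
  contradiction (≡.subst (_∈ₗ _) (≡.sym eq) (∈ₗ.∈-lookup j)) (Unique.Unique[x∷xs]⇒x∉xs u)
lookup-injective {xs = _ ∷ _} u (suc i) zero    eq =
  contradiction (≡.subst (_∈ₗ _) eq (∈ₗ.∈-lookup i)) (Unique.Unique[x∷xs]⇒x∉xs u)
lookup-injective {xs = _ ∷ _} (_ ∷ u) (suc i) (suc j) eq = ≡.cong suc (lookup-injective u i j eq)

-- Finite sums indexed by lists

module ListSum {c ℓ : Level} (R : CommutativeSemiring c ℓ) where

  open CommutativeSemiring R hiding (zero)
  open import Algebra.Properties.CommutativeMonoid.Sum +-commutativeMonoid using (sum)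
  open import Algebra.Properties.CommutativeSemigroup
    (CommutativeSemiring.+-commutativeSemigroup R) using (interchange)
  open import Relation.Binary.Reasoning.Setoid setoid

  -- Written as a fold after a map, so that over the naturals `f G i` is such a sum by computation.
  ∑ : ∀ {a} {A : Set a} → (A → Carrier) → List A → Carrier
  ∑ g xs = List.foldr _+_ 0# (List.map g xs)

  module _ {a : Level} {A : Set a} where

    ∑-cong-∈ : ∀ {g h : A → Carrier} xs → (∀ {y} → y ∈ₗ xs → g y ≈ h y) → ∑ g xs ≈ ∑ h xs
    ∑-cong-∈ []       eq = refl
    ∑-cong-∈ (y ∷ xs) eq = +-cong (eq (here ≡.refl)) (∑-cong-∈ xs (eq ∘ there))

    ∑-cong : ∀ {g h : A → Carrier} xs → (∀ y → g y ≈ h y) → ∑ g xs ≈ ∑ h xs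
    ∑-cong xs eq = ∑-cong-∈ xs (λ {y} _ → eq y)

    ∑-zero : ∀ {g : A → Carrier} xs → (∀ {y} → y ∈ₗ xs → g y ≈ 0#) → ∑ g xs ≈ 0#
    ∑-zero []       eq = refl
    ∑-zero (y ∷ xs) eq =
      trans (+-cong (eq (here ≡.refl)) (∑-zero xs (eq ∘ there))) (+-identityˡ 0#)

    ∑-++ : ∀ (g : A → Carrier) xs ys → ∑ g (xs ++ ys) ≈ ∑ g xs + ∑ g ys
    ∑-++ g []       ys = sym (+-identityˡ _)
    ∑-++ g (x ∷ xs) ys = trans (+-congˡ (∑-++ g xs ys)) (sym (+-assoc _ _ _))

    ∑-distrib-+ : ∀ (g h : A → Carrier) xs → ∑ (λ y → g y + h y) xs ≈ ∑ g xs + ∑ h xs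
    ∑-distrib-+ g h []       = sym (+-identityˡ 0#)
    ∑-distrib-+ g h (y ∷ xs) = trans (+-congˡ (∑-distrib-+ g h xs)) (interchange _ _ _ _)

    *-distribˡ-∑ : ∀ r (g : A → Carrier) xs → r * ∑ g xs ≈ ∑ (λ y → r * g y) xs
    *-distribˡ-∑ r g []       = zeroʳ r
    *-distribˡ-∑ r g (y ∷ xs) = trans (distribˡ _ _ _) (+-congˡ (*-distribˡ-∑ r g xs))

    ∑-lookup : ∀ (g : A → Carrier) xs →
               sum {List.length xs} (λ i → g (List.lookup xs i)) ≈ ∑ g xs
    ∑-lookup g []       = refl
    ∑-lookup g (y ∷ xs) = +-congˡ (∑-lookup g xs)

    ∑-select : ∀ (g : A → Carrier) {xs} → Unique xs → ∀ {y} → y ∈ₗ xs →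
               (∀ {x} → x ∈ₗ xs → x ≢ y → g x ≈ 0#) → ∑ g xs ≈ g y
    ∑-select g {x ∷ xs} u (here ≡.refl) vanish =
      trans (+-congˡ (∑-zero xs (λ y∈ → vanish (there y∈)
        λ { ≡.refl → Unique.Unique[x∷xs]⇒x∉xs u y∈ }))) (+-identityʳ _)
    ∑-select g {x ∷ xs} u@(_ ∷ u′) (there y∈) vanish = trans
      (+-cong (vanish (here ≡.refl) λ { ≡.refl → Unique.Unique[x∷xs]⇒x∉xs u y∈ })
              (∑-select g u′ y∈ (vanish ∘ there)))
      (+-identityˡ _)

  module _ {a b : Level} {A : Set a} {B : Set b} where

    ∑-map : ∀ (g : B → Carrier) (h : A → B) xs → ∑ g (List.map h xs) ≈ ∑ (g ∘ h) xs
    ∑-map g h []       = refl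
    ∑-map g h (y ∷ xs) = +-congˡ (∑-map g h xs)

    ∑-concatMap : ∀ (g : B → Carrier) (h : A → List B) xs →
                  ∑ g (List.concatMap h xs) ≈ ∑ (λ y → ∑ g (h y)) xs
    ∑-concatMap g h []       = refl
    ∑-concatMap g h (y ∷ xs) = trans (∑-++ g (h y) _) (+-congˡ (∑-concatMap g h xs))

    ∑-comm : ∀ (g : A → B → Carrier) xs ys →
             ∑ (λ x → ∑ (g x) ys) xs ≈ ∑ (λ y → ∑ (λ x → g x y) xs) ys
    ∑-comm g []       ys = sym (∑-zero ys (λ _ → refl))
    ∑-comm g (x ∷ xs) ys =
      trans (+-congˡ (∑-comm g xs ys)) (sym (∑-distrib-+ (g x) _ ys))

  ∑-tabulate : ∀ {a} {A : Set a} (g : A → Carrier) {n} (h : Fin n → A) →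
               ∑ g (List.tabulate h) ≈ sum (g ∘ h)
  ∑-tabulate g {zero}  h = refl
  ∑-tabulate g {suc n} h = +-congˡ (∑-tabulate g (h ∘ suc))

  sum-select : ∀ {n} (g : Fin n → Carrier) k → (∀ i → i ≢ k → g i ≈ 0#) → sum g ≈ g k
  sum-select g k vanish = trans (sym (∑-tabulate g id))
    (∑-select g (Unique.allFin⁺ _) (∈ₗ.∈-allFin k) (λ {i} _ → vanish i))

-- Coefficients of t^i / (1 - t)^(i+1)

module Counting where

  open import Data.Nat.Base using (_+_; _*_)
  open ≡ using (refl; sym; trans; cong; cong₂; subst; module ≡-Reasoning)

  module Series where

    open PowerSeries renaming (_*_ to _⊛_; _^_ to _^ˢ_)
    open import Algebra.Properties.CommutativeMonoid.Sum ℤ.+-0-commutativeMonoid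
      using (sum; sum-cong-≗; sum-replicate-zero)
    open ≡-Reasoning

    sum-zero : ∀ {n} (g : Fin n → ℤ) → (∀ i → g i ≡ 0ℤ) → sum g ≡ 0ℤ
    sum-zero {n} g eq = trans (sum-cong-≗ eq) (sum-replicate-zero n)

    one-* : ∀ q → one ⊛ q ≗ q
    one-* q d = begin
      1ℤ ℤ.* q d ℤ.+ sum {d} (λ k → 0ℤ ℤ.* q (d ∸ suc (toℕ k)))
        ≡⟨ cong₂ ℤ._+_ (ℤ.*-identityˡ (q d)) (sum-zero {d} _ (λ _ → refl)) ⟩
      q d ℤ.+ 0ℤ
        ≡⟨ ℤ.+-identityʳ (q d) ⟩
      q d ∎

    t-*-zero : ∀ p q → ((t ⊛ p) ⊛ q) 0 ≡ 0ℤ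
    t-*-zero p q = refl

    -- The bracketing is that of `t ^ suc i * q` after unfolding the power, so the shift needs no
    -- associativity of the convolution.
    t-*-suc : ∀ p q d → ((t ⊛ p) ⊛ q) (suc d) ≡ (p ⊛ q) d
    t-*-suc p q d = begin
      0ℤ ℤ.* q (suc d) ℤ.+ sum {suc d} (λ k → (t ⊛ p) (suc (toℕ k)) ℤ.* q (d ∸ toℕ k))
        ≡⟨ ℤ.+-identityˡ _ ⟩
      sum {suc d} (λ k → (t ⊛ p) (suc (toℕ k)) ℤ.* q (d ∸ toℕ k))
        ≡⟨ sum-cong-≗ {suc d} (λ k → cong (ℤ._* q (d ∸ toℕ k)) (shift (toℕ k))) ⟩
      (p ⊛ q) d ∎
      where
      shift : ∀ k → (t ⊛ p) (suc k) ≡ p k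
      shift k = trans (ℤ.+-identityˡ _) (one-* p k)

    1/[1-t]-*-suc : ∀ q d → (1/[1-t] ⊛ q) (suc d) ≡ q (suc d) ℤ.+ (1/[1-t] ⊛ q) d
    1/[1-t]-*-suc q d = cong (ℤ._+ (1/[1-t] ⊛ q) d) (ℤ.*-identityˡ (q (suc d)))

    -- Multiplication by the geometric series takes partial sums, and the resulting recurrence in
    -- `n` and `d` is Pascal's rule.
    1/[1-t]-^ : ∀ n d → (1/[1-t] ^ˢ suc n) d ≡ + ((n + d) C n)
    1/[1-t]-^ n zero = begin
      1ℤ ℤ.* (1/[1-t] ^ˢ n) 0 ℤ.+ 0ℤ
        ≡⟨ trans (ℤ.+-identityʳ _) (ℤ.*-identityˡ _) ⟩
      (1/[1-t] ^ˢ n) 0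
        ≡⟨ constant n ⟩
      + 1
        ≡⟨ cong +_ (sym (trans (cong (_C n) (ℕ.+-identityʳ n)) (nCn≡1 n))) ⟩
      + ((n + 0) C n) ∎
      where
      constant : ∀ n → (1/[1-t] ^ˢ n) 0 ≡ + 1
      constant zero    = refl
      constant (suc n) = trans (trans (ℤ.+-identityʳ _) (ℤ.*-identityˡ _)) (constant n)
    1/[1-t]-^ zero (suc d) =
      trans (1/[1-t]-*-suc one d) (trans (ℤ.+-identityˡ _) (1/[1-t]-^ zero d))
    1/[1-t]-^ (suc n) (suc d) = begin
      (1/[1-t] ^ˢ suc (suc n)) (suc d)
        ≡⟨ 1/[1-t]-*-suc (1/[1-t] ^ˢ suc n) d ⟩
      (1/[1-t] ^ˢ suc n) (suc d) ℤ.+ (1/[1-t] ^ˢ suc (suc n)) d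
        ≡⟨ cong₂ ℤ._+_ (1/[1-t]-^ n (suc d)) (1/[1-t]-^ (suc n) d) ⟩
      + ((n + suc d) C n + (suc n + d) C suc n)
        ≡⟨ cong (λ m → + (m C n + (suc n + d) C suc n)) (ℕ.+-suc n d) ⟩
      + ((suc n + d) C n + (suc n + d) C suc n)
        ≡⟨ cong +_ (nCk+nC[k+1]≡[n+1]C[k+1] (suc n + d) n) ⟩
      + ((suc (suc n + d)) C suc n)
        ≡⟨ cong (λ m → + (suc m C suc n)) (sym (ℕ.+-suc n d)) ⟩
      + ((suc n + suc d) C suc n) ∎

    -- The power of `t` shifts the previous series by `i`, which turns `(i + (d ∸ i)) C i` into
    -- `d C i`. In degrees below `i` both sides vanish.
    tⁱ/[1-t]ⁱ⁺¹ : ∀ i d → (t ^ˢ i ⊛ 1/[1-t] ^ˢ suc i) d ≡ + (d C i)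
    tⁱ/[1-t]ⁱ⁺¹ i d with i ℕ.≤? d
    ... | no i≰d  = trans (below (1/[1-t] ^ˢ suc i) i d (ℕ.≰⇒> i≰d))
                          (cong +_ (sym (k>n⇒nCk≡0 (ℕ.≰⇒> i≰d))))
      where
      below : ∀ q i d → d < i → (t ^ˢ i ⊛ q) d ≡ 0ℤ
      below q (suc i) zero    _         = t-*-zero (t ^ˢ i) q
      below q (suc i) (suc d) (s≤s d<i) = trans (t-*-suc (t ^ˢ i) q d) (below q i d d<i)
    ... | yes i≤d = begin
      (t ^ˢ i ⊛ 1/[1-t] ^ˢ suc i) d
        ≡⟨ cong (t ^ˢ i ⊛ 1/[1-t] ^ˢ suc i) (sym (ℕ.m+[n∸m]≡n i≤d)) ⟩
      (t ^ˢ i ⊛ 1/[1-t] ^ˢ suc i) (i + (d ∸ i))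
        ≡⟨ shift (1/[1-t] ^ˢ suc i) i (d ∸ i) ⟩
      (1/[1-t] ^ˢ suc i) (d ∸ i)
        ≡⟨ 1/[1-t]-^ i (d ∸ i) ⟩
      + ((i + (d ∸ i)) C i)
        ≡⟨ cong (λ m → + (m C i)) (ℕ.m+[n∸m]≡n i≤d) ⟩
      + (d C i) ∎
      where
      shift : ∀ q i e → (t ^ˢ i ⊛ q) (i + e) ≡ q e
      shift q zero    e = one-* q e
      shift q (suc i) e = trans (t-*-suc (t ^ˢ i) q (i + e)) (shift q i e)

  -- Exponent vectors counted by their zero sets

  isZero : ℕ → Side
  isZero zero    = inside
  isZero (suc _) = outside

  zeros : ∀ {n} → Vec ℕ n → Subset n
  zeros = Vec.map isZero

  incrementHead : ∀ {n} → Vec ℕ (suc n) → Vec ℕ (suc n)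
  incrementHead (k ∷ a) = suc k ∷ a

  -- The vectors of total at most `d`, not exactly `d`: the missing degree goes to z. The recursion
  -- separates zero heads from positive heads, the split that Pascal's rule makes on the binomial
  -- coefficients.
  exponents : ∀ n → ℕ → List (Vec ℕ n)
  exponents zero    d       = [] ∷ []
  exponents (suc n) zero    = List.map (0 ∷_) (exponents n zero)
  exponents (suc n) (suc d) =
    List.map (0 ∷_) (exponents n (suc d)) ++ List.map incrementHead (exponents (suc n) d)

  ∈-exponents⁺ : ∀ {n} d (a : Vec ℕ n) → Vec.sum a ≤ d → a ∈ₗ exponents n d
  ∈-exponents⁺ d       []          _       = here refl
  ∈-exponents⁺ zero    (zero  ∷ a) le      = ∈ₗ.∈-map⁺ (0 ∷_) (∈-exponents⁺ zero a le)
  ∈-exponents⁺ (suc d) (zero  ∷ a) le      = ∈ₗ.∈-++⁺ˡ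
    (∈ₗ.∈-map⁺ (0 ∷_) (∈-exponents⁺ (suc d) a le))
  ∈-exponents⁺ (suc d) (suc k ∷ a) (s≤s le) =
    ∈ₗ.∈-++⁺ʳ (List.map (0 ∷_) (exponents _ (suc d)))
      (∈ₗ.∈-map⁺ incrementHead (∈-exponents⁺ d (k ∷ a) le))

  ∈-exponents⁻ : ∀ {n} d {a : Vec ℕ n} → a ∈ₗ exponents n d → Vec.sum a ≤ d
  ∈-exponents⁻ {zero}  d       {[]} _ = z≤n
  ∈-exponents⁻ {suc n} zero    a∈ with ∈ₗ.∈-map⁻ (0 ∷_) a∈
  ... | b , b∈ , refl = ∈-exponents⁻ zero b∈
  ∈-exponents⁻ {suc n} (suc d) a∈ with ∈ₗ.∈-++⁻ (List.map (0 ∷_) (exponents n (suc d))) a∈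
  ... | inj₁ a∈ˡ with ∈ₗ.∈-map⁻ (0 ∷_) a∈ˡ
  ...   | b , b∈ , refl = ∈-exponents⁻ (suc d) b∈
  ∈-exponents⁻ {suc n} (suc d) a∈ | inj₂ a∈ʳ with ∈ₗ.∈-map⁻ incrementHead a∈ʳ
  ...   | (k ∷ b) , b∈ , refl = s≤s (∈-exponents⁻ d b∈)

  exponents-unique : ∀ n d → Unique (exponents n d)
  exponents-unique zero    d       = [] ∷ []
  exponents-unique (suc n) zero    = Unique.map⁺ (cong Vec.tail) (exponents-unique n zero)
  exponents-unique (suc n) (suc d) = Unique.++⁺
    (Unique.map⁺ (cong Vec.tail) (exponents-unique n (suc d)))
    (Unique.map⁺ incrementHead-injective (exponents-unique (suc n) d))
    λ (∈ˡ , ∈ʳ) → disjoint ∈ˡ ∈ʳ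
    where
    incrementHead-injective : ∀ {n} {a b : Vec ℕ (suc n)} →
                              incrementHead a ≡ incrementHead b → a ≡ b
    incrementHead-injective {a = _ ∷ _} {_ ∷ _} refl = refl
    disjoint : ∀ {a} → a ∈ₗ List.map (0 ∷_) (exponents n (suc d)) →
               ¬ a ∈ₗ List.map incrementHead (exponents (suc n) d)
    disjoint ∈ˡ ∈ʳ with ∈ₗ.∈-map⁻ (0 ∷_) ∈ˡ | ∈ₗ.∈-map⁻ incrementHead ∈ʳ
    ... | _ , _ , refl | (_ ∷ _) , _ , ()

  open ListSum ℕ.+-*-commutativeSemiring

  ∑-subsets : ∀ {n} (g : Subset (suc n) → ℕ) →
              ∑ g (subsets (suc n)) ≡
              ∑ (λ W → g (outside ∷ W)) (subsets n) + ∑ (λ W → g (inside ∷ W)) (subsets n)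
  ∑-subsets {n} g = trans (∑-++ g (List.map (outside ∷_) (subsets n)) _)
    (cong₂ _+_ (∑-map g (outside ∷_) (subsets n)) (∑-map g (inside ∷_) (subsets n)))

  codim : ∀ {n} → Subset n → ℕ
  codim {n} W = n ∸ ∣ W ∣

  codim-outside : ∀ {n} (W : Subset n) → codim (outside ∷ W) ≡ suc (codim W)
  codim-outside W = ℕ.+-∸-assoc 1 (Subset.∣p∣≤n W)

  -- Pascal's rule splits off the exponent vectors with positive head.
  ∑-exponents : ∀ n d (g : Subset n → ℕ) →
                ∑ (g ∘ zeros) (exponents n d) ≡ ∑ (λ W → g W * (d C codim W)) (subsets n)
  ∑-exponents zero d g = cong (_+ 0) (sym (ℕ.*-identityʳ (g [])))
  ∑-exponents (suc n) zero g = begin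
    ∑ (g ∘ zeros) (List.map (0 ∷_) (exponents n 0))
      ≡⟨ ∑-map (g ∘ zeros) (0 ∷_) (exponents n 0) ⟩
    ∑ (λ a → g (inside ∷ zeros a)) (exponents n 0)
      ≡⟨ ∑-exponents n 0 (λ W → g (inside ∷ W)) ⟩
    ∑ (λ W → g (inside ∷ W) * (0 C codim W)) (subsets n)
      -- Sets that omit the first vertex have positive codimension, and `0 C suc k` computes to 0.
      ≡⟨ cong (_+ ∑ (λ W → g (inside ∷ W) * (0 C codim W)) (subsets n))
           (sym (∑-zero (subsets n) (λ {W} _ →
           trans (cong (λ m → g (outside ∷ W) * (0 C m)) (codim-outside W))
             (ℕ.*-zeroʳ (g (outside ∷ W)))))) ⟩
    ∑ (λ W → g (outside ∷ W) * (0 C codim (outside ∷ W))) (subsets n) +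
    ∑ (λ W → g (inside ∷ W) * (0 C codim W)) (subsets n)
      ≡⟨ sym (∑-subsets (λ W → g W * (0 C codim W))) ⟩
    ∑ (λ W → g W * (0 C codim W)) (subsets (suc n)) ∎
    where open ≡-Reasoning
  ∑-exponents (suc n) (suc d) g = begin
    ∑ (g ∘ zeros) (List.map (0 ∷_) (exponents n (suc d)) ++ List.map incrementHead
      (exponents (suc n) d))
      ≡⟨ ∑-++ (g ∘ zeros) (List.map (0 ∷_) (exponents n (suc d))) _ ⟩
    ∑ (g ∘ zeros) (List.map (0 ∷_) (exponents n (suc d))) +
    ∑ (g ∘ zeros) (List.map incrementHead (exponents (suc n) d))
      ≡⟨ cong₂ _+_ zeroHead positiveHead ⟩
    In + (∑ (λ W → g (outside ∷ W) * (d C codim (outside ∷ W))) (subsets n) +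
          ∑ (λ W → g (outside ∷ W) * (d C codim W)) (subsets n))
      ≡⟨ ℕ.+-comm In _ ⟩
    ∑ (λ W → g (outside ∷ W) * (d C codim (outside ∷ W))) (subsets n) +
    ∑ (λ W → g (outside ∷ W) * (d C codim W)) (subsets n) + In
      ≡⟨ cong (_+ In) (sym (∑-distrib-+ _ _ (subsets n))) ⟩
    ∑ (λ W → g (outside ∷ W) * (d C codim (outside ∷ W)) + g (outside ∷ W) * (d C codim W))
      (subsets n) + In
      ≡⟨ cong (_+ In) (∑-cong (subsets n) pascal) ⟩
    ∑ (λ W → g (outside ∷ W) * (suc d C codim (outside ∷ W))) (subsets n) + In
      ≡⟨ sym (∑-subsets (λ W → g W * (suc d C codim W))) ⟩
    ∑ (λ W → g W * (suc d C codim W)) (subsets (suc n)) ∎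
    where
    open ≡-Reasoning

    In = ∑ (λ W → g (inside ∷ W) * (suc d C codim W)) (subsets n)

    zeroHead : ∑ (g ∘ zeros) (List.map (0 ∷_) (exponents n (suc d))) ≡ In
    zeroHead = trans (∑-map (g ∘ zeros) (0 ∷_) (exponents n (suc d)))
                     (∑-exponents n (suc d) (λ W → g (inside ∷ W)))

    positiveHead : ∑ (g ∘ zeros) (List.map incrementHead (exponents (suc n) d)) ≡
                   ∑ (λ W → g (outside ∷ W) * (d C codim (outside ∷ W))) (subsets n) +
                   ∑ (λ W → g (outside ∷ W) * (d C codim W)) (subsets n)
    positiveHead = begin
      ∑ (g ∘ zeros) (List.map incrementHead (exponents (suc n) d))
        ≡⟨ ∑-map (g ∘ zeros) incrementHead (exponents (suc n) d) ⟩
      ∑ (g ∘ zeros ∘ incrementHead) (exponents (suc n) d)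
        -- After the increment the head is nonzero whatever it was before. `Vec.tail` forgets the
        -- old head, and its two possibilities, zero or positive, give the two sums at the end.
        ≡⟨ ∑-cong (exponents (suc n) d) (λ { (_ ∷ _) → refl }) ⟩
      ∑ (λ a → g (outside ∷ Vec.tail (zeros a))) (exponents (suc n) d)
        ≡⟨ ∑-exponents (suc n) d (λ W → g (outside ∷ Vec.tail W)) ⟩
      ∑ (λ W → g (outside ∷ Vec.tail W) * (d C codim W)) (subsets (suc n))
        ≡⟨ ∑-subsets (λ W → g (outside ∷ Vec.tail W) * (d C codim W)) ⟩
      ∑ (λ W → g (outside ∷ W) * (d C codim (outside ∷ W))) (subsets n) +
      ∑ (λ W → g (outside ∷ W) * (d C codim W)) (subsets n) ∎

    pascal : ∀ W → g (outside ∷ W) * (d C codim (outside ∷ W)) + g (outside ∷ W) * (d C codim W) ≡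
                   g (outside ∷ W) * (suc d C codim (outside ∷ W))
    pascal W = begin
      g (outside ∷ W) * (d C codim (outside ∷ W)) + g (outside ∷ W) * (d C codim W)
        ≡⟨ sym (ℕ.*-distribˡ-+ (g (outside ∷ W)) (d C codim (outside ∷ W)) (d C codim W)) ⟩
      g (outside ∷ W) * (d C codim (outside ∷ W) + d C codim W)
        ≡⟨ cong (λ m → g (outside ∷ W) * (d C m + d C codim W)) (codim-outside W) ⟩
      g (outside ∷ W) * (d C suc (codim W) + d C codim W)
        ≡⟨ cong (g (outside ∷ W) *_) (trans (ℕ.+-comm (d C suc (codim W)) _)
             (nCk+nC[k+1]≡[n+1]C[k+1] d (codim W))) ⟩
      g (outside ∷ W) * (suc d C suc (codim W))
        ≡⟨ cong (λ m → g (outside ∷ W) * (suc d C m)) (sym (codim-outside W)) ⟩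
      g (outside ∷ W) * (suc d C codim (outside ∷ W)) ∎

  -- The sum in the theorem stops at i = ℓ - 1 and so skips the empty set, whereas `∑-exponents`
  -- ranges over all subsets. The two agree because every component contains a vertex.
  c-empty : ∀ {n} (G : SimpleGraph (Fin n)) W → ∣ W ∣ ≡ 0 → c G W ≡ 0
  c-empty G W ∣W∣≡0 with c G W | c-correct G W
  ... | zero  | _            = refl
  ... | suc _ | _ , surj , _ with surj zero
  ...   | v , _ = nonempty W ∣W∣≡0 v
    where
    nonempty : ∀ {n} {A : Set} (W : Subset n) → ∣ W ∣ ≡ 0 → ∃ (_∈ W) → A
    nonempty (outside ∷ W) eq (suc v , Vec.there v∈) = nonempty W eq (v , v∈)

  ∑-filter : ∀ {a p} {A : Set a} {P : Pred A p} (P? : Decidable P) (g : A → ℕ) xs →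
             ∑ g (List.filter P? xs) ≡ ∑ (λ y → if does (P? y) then g y else 0) xs
  ∑-filter P? g []       = refl
  ∑-filter P? g (y ∷ xs) with does (P? y)
  ... | true  = cong (_+_ (g y)) (∑-filter P? g xs)
  ... | false = ∑-filter P? g xs

  module _ {n : ℕ} (G : SimpleGraph (Fin n)) (d : ℕ) where

    open ≡-Reasoning
    open import Algebra.Properties.CommutativeMonoid.Sum ℤ.+-0-commutativeMonoid
      using () renaming (sum to sumᶻ; sum-cong-≗ to sumᶻ-cong)
    open import Algebra.Properties.CommutativeMonoid.Sum ℕ.+-0-commutativeMonoid using
      (sum; sum-cong-≗)

    private
      term : Subset n → Fin n → ℕ
      term W i = (if does (∣ W ∣ ℕ.≟ n ∸ toℕ i) then c G W else 0) * (d C toℕ i)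

      -- A nonempty `W` is counted for exactly one `i`, its codimension, which is below `n` because
      -- `W` has a vertex. The empty set would need `i = n`, but has no components.
      ∑-term : ∀ W → ∑ (term W) (allFin n) ≡ c G W * (d C codim W)
      ∑-term W with ∣ W ∣ ℕ.≟ 0
      ... | yes ∣W∣≡0 = trans (∑-zero (allFin n) (λ {i} _ → vanish i))
                              (cong (_* (d C codim W)) (sym (c-empty G W ∣W∣≡0)))
        where
        vanish : ∀ i → term W i ≡ 0
        vanish i with does (∣ W ∣ ℕ.≟ n ∸ toℕ i)
        ... | true  = cong (_* (d C toℕ i)) (c-empty G W ∣W∣≡0)
        ... | false = refl
      ... | no ∣W∣≢0 = trans
        (∑-select (term W) (Unique.allFin⁺ n) (∈ₗ.∈-allFin k) (λ {i} _ → vanish i))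
        hit
        where
        k<n : codim W < n
        k<n = ℕ.∸-monoʳ-< (ℕ.n≢0⇒n>0 ∣W∣≢0) (Subset.∣p∣≤n W)
        k : Fin n
        k = fromℕ< k<n
        ∣W∣≡ : ∣ W ∣ ≡ n ∸ toℕ k
        ∣W∣≡ = trans (sym (ℕ.m∸[m∸n]≡n (Subset.∣p∣≤n W))) (cong (n ∸_) (sym (Fin.toℕ-fromℕ< k<n)))
        vanish : ∀ i → i ≢ k → term W i ≡ 0
        vanish i i≢k = cong (λ b → (if b then c G W else 0) * (d C toℕ i))
          (dec-false (∣ W ∣ ℕ.≟ n ∸ toℕ i) λ eq → i≢k (Fin.toℕ-injective
            (ℕ.∸-cancelˡ-≡ (ℕ.<⇒≤ (Fin.toℕ<n i)) (ℕ.<⇒≤ (Fin.toℕ<n k)) (trans (sym eq) ∣W∣≡))))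
        hit : term W k ≡ c G W * (d C codim W)
        hit = trans
          (cong (λ b → (if b then c G W else 0) * (d C toℕ k))
            (dec-true (∣ W ∣ ℕ.≟ n ∸ toℕ k) ∣W∣≡))
          (cong (λ m → c G W * (d C m)) (Fin.toℕ-fromℕ< k<n))

    f-* : ∀ i → f G (toℕ i) * (d C toℕ i) ≡ ∑ (λ W → term W i) (subsets n)
    f-* i = begin
      f G (toℕ i) * (d C toℕ i)
        ≡⟨ cong (_* (d C toℕ i)) (∑-filter (λ W → ∣ W ∣ ℕ.≟ n ∸ toℕ i) (c G) (subsets n)) ⟩
      ∑ restricted (subsets n) * (d C toℕ i)
        ≡⟨ ℕ.*-comm (∑ restricted (subsets n)) _ ⟩
      (d C toℕ i) * ∑ restricted (subsets n)
        ≡⟨ *-distribˡ-∑ (d C toℕ i) restricted (subsets n) ⟩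
      ∑ (λ W → (d C toℕ i) * restricted W) (subsets n)
        ≡⟨ ∑-cong (subsets n) (λ W → ℕ.*-comm (d C toℕ i) _) ⟩
      ∑ (λ W → term W i) (subsets n) ∎
      where
      restricted : Subset n → ℕ
      restricted W = if does (∣ W ∣ ℕ.≟ n ∸ toℕ i) then c G W else 0

    sum-+ : ∀ {m} (g : Fin m → ℕ) → sumᶻ (λ i → + g i) ≡ + sum g
    sum-+ {zero}  g = refl
    sum-+ {suc m} g = cong (ℤ._+_ (+ g zero)) (sum-+ (g ∘ suc))

    open PowerSeries using (sum-series; _·_; 1/[1-t]) renaming (_*_ to _⊛_; _^_ to _^ˢ_; t to 𝑡)

    -- The right side counts the pairs of an exponent vector and a component, which will index the
    -- basis. Exchanging the sums over `i` and `W` brings the left side to the form that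
    -- `∑-exponents` evaluates.
    hilbert-coefficient :
      (∑[ i < n ] ((+ f G (toℕ i)) · (𝑡 ^ˢ toℕ i ⊛ 1/[1-t] ^ˢ suc (toℕ i)))) d ≡
      + ∑ (c G ∘ zeros) (exponents n d)
    hilbert-coefficient = begin
      sumᶻ {n} (λ i → (+ f G (toℕ i)) ℤ.* (𝑡 ^ˢ toℕ i ⊛ 1/[1-t] ^ˢ suc (toℕ i)) d)
        ≡⟨ sumᶻ-cong {n} (λ i → trans (cong (ℤ._*_ (+ f G (toℕ i))) (Series.tⁱ/[1-t]ⁱ⁺¹ (toℕ i) d))
                               (sym (ℤ.pos-* (f G (toℕ i)) _))) ⟩
      sumᶻ {n} (λ i → + (f G (toℕ i) * (d C toℕ i)))
        ≡⟨ sum-+ {n} (λ i → f G (toℕ i) * (d C toℕ i)) ⟩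
      + sum {n} (λ i → f G (toℕ i) * (d C toℕ i))
        ≡⟨ cong +_ (begin
          sum {n} (λ i → f G (toℕ i) * (d C toℕ i))
            ≡⟨ sum-cong-≗ {n} f-* ⟩
          sum {n} (λ i → ∑ (λ W → term W i) (subsets n))
            ≡⟨ sym (∑-tabulate (λ i → ∑ (λ W → term W i) (subsets n)) id) ⟩
          ∑ (λ i → ∑ (λ W → term W i) (subsets n)) (allFin n)
            ≡⟨ ∑-comm (λ i W → term W i) (allFin n) (subsets n) ⟩
          ∑ (λ W → ∑ (term W) (allFin n)) (subsets n)
            ≡⟨ ∑-cong (subsets n) ∑-term ⟩
          ∑ (λ W → c G W * (d C codim W)) (subsets n)
            ≡⟨ sym (∑-exponents n d (c G)) ⟩
          ∑ (c G ∘ zeros) (exponents n d) ∎) ⟩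
      + ∑ (c G ∘ zeros) (exponents n d) ∎

open Counting using (zeros; exponents; ∈-exponents⁺; ∈-exponents⁻; exponents-unique; hilbert-coefficient)

-- Exponent vectors, and monomials evaluated in a commutative ring

infixl 6 _⊕_
_⊕_ : ∀ {n} → Vec ℕ n → Vec ℕ n → Vec ℕ n
_⊕_ = Vec.zipWith ℕ._+_

𝟎 : ∀ {n} → Vec ℕ n
𝟎 = Vec.replicate _ 0

unit : ∀ {n} → Fin n → Vec ℕ n
unit i = 𝟎 Vec.[ i ]≔ 1

⊕-identityˡ : ∀ {n} (m : Vec ℕ n) → 𝟎 ⊕ m ≡ m
⊕-identityˡ = Vec.zipWith-identityˡ ℕ.+-identityˡ

⊕-comm : ∀ {n} (m m′ : Vec ℕ n) → m ⊕ m′ ≡ m′ ⊕ m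
⊕-comm = Vec.zipWith-comm ℕ.+-comm

⊕-assoc : ∀ {n} (m m′ m″ : Vec ℕ n) → (m ⊕ m′) ⊕ m″ ≡ m ⊕ (m′ ⊕ m″)
⊕-assoc = Vec.zipWith-assoc ℕ.+-assoc

import Algebra.Properties.Semiring.Exp

module _ {b ℓ : Level} (B : CommutativeRing b ℓ) where

  open CommutativeRing B hiding (zero)
  open import Algebra.Properties.Semiring.Exp semiring
  open import Algebra.Properties.CommutativeSemigroup *-commutativeSemigroup
    using (interchange; xy∙z≈xz∙y)
  open import Relation.Binary.Reasoning.Setoid setoid

  monomial : ∀ {n} → (Fin n → Carrier) → Vec ℕ n → Carrier
  monomial b []      = 1#
  monomial b (j ∷ m) = b zero ^ j * monomial (b ∘ suc) m

  monomial-cong : ∀ {n} {b b′ : Fin n → Carrier} → (∀ i → b i ≈ b′ i) →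
                  ∀ m → monomial b m ≈ monomial b′ m
  monomial-cong eq []      = refl
  monomial-cong eq (j ∷ m) = *-cong (^-congˡ j (eq zero)) (monomial-cong (eq ∘ suc) m)

  monomial-⊕ : ∀ {n} (b : Fin n → Carrier) m m′ →
               monomial b (m ⊕ m′) ≈ monomial b m * monomial b m′
  monomial-⊕ b []      []        = sym (*-identityˡ 1#)
  monomial-⊕ b (j ∷ m) (j′ ∷ m′) = trans
    (*-cong (^-homo-* (b zero) j j′) (monomial-⊕ (b ∘ suc) m m′))
    (interchange _ _ _ _)

  monomial-𝟎 : ∀ {n} (b : Fin n → Carrier) → monomial b 𝟎 ≈ 1#
  monomial-𝟎 {zero}  b = refl
  monomial-𝟎 {suc n} b = trans (*-identityˡ _) (monomial-𝟎 (b ∘ suc))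

  monomial-unit : ∀ {n} (b : Fin n → Carrier) i → monomial b (unit i) ≈ b i
  monomial-unit b zero    =
    trans (*-congˡ (monomial-𝟎 (b ∘ suc))) (trans (*-identityʳ _) (*-identityʳ _))
  monomial-unit b (suc i) = trans (*-identityˡ _) (monomial-unit (b ∘ suc) i)

  monomial-zero : ∀ {n} (b : Fin n → Carrier) i m → Vec.lookup m i ≢ 0 → b i ≈ 0# →
                  monomial b m ≈ 0#
  monomial-zero b zero    (zero  ∷ m) ≢0 _  = contradiction ≡.refl ≢0
  monomial-zero b zero    (suc j ∷ m) _  eq =
    trans (*-congʳ (trans (*-congʳ eq) (zeroˡ _))) (zeroˡ _)
  monomial-zero b (suc i) (j ∷ m)     ≢0 eq =
    trans (*-congˡ (monomial-zero (b ∘ suc) i m ≢0 eq)) (zeroʳ _)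

  open import Algebra.Properties.AbelianGroup +-abelianGroup using (xyx⁻¹≈y; ⁻¹-anti-homo‿-)

  x-[x-y]≈y : ∀ x y → x - (x - y) ≈ y
  x-[x-y]≈y x y = trans (+-congˡ (⁻¹-anti-homo‿- x y))
    (trans (sym (+-assoc x y (- x))) (xyx⁻¹≈y x y))

  [z-x]-[z-y]≈y-x : ∀ x y z → (z - x) - (z - y) ≈ y - x
  [z-x]-[z-y]≈y-x x y z = begin
    (z - x) - (z - y)     ≈⟨ +-congʳ (+-comm z (- x)) ⟩
    - x + z - (z - y)     ≈⟨ +-assoc _ _ _ ⟩
    - x + (z - (z - y))   ≈⟨ +-congˡ (x-[x-y]≈y z y) ⟩
    - x + y               ≈⟨ +-comm _ _ ⟩
    y - x                 ∎

  -- Congruence modulo a principal ideal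

  module Congruence (g : Carrier) where

    infix 4 _~_
    -- The cofactor is kept as data, because membership in `D` asks for it.
    _~_ : Carrier → Carrier → Set (b ⊔ ℓ)
    x ~ y = ∃ λ r → x ≈ y + r * g

    ~-reflexive : ∀ {x y} → x ≈ y → x ~ y
    ~-reflexive eq = 0# , trans eq (sym (trans (+-congˡ (zeroˡ g)) (+-identityʳ _)))

    ~-resp : ∀ {x x′ y y′} → x ≈ x′ → y ≈ y′ → x′ ~ y′ → x ~ y
    ~-resp eq eq′ (r , eq″) = r , trans eq (trans eq″ (+-congʳ (sym eq′)))

    ~⇒∣- : ∀ {x y} → x ~ y → ∃ λ r → x - y ≈ r * g
    ~⇒∣- {x} {y} (r , eq) = r , trans (+-congʳ eq) (xyx⁻¹≈y y (r * g))

    +-cong-~ : ∀ {x y x′ y′} → x ~ y → x′ ~ y′ → x + x′ ~ y + y′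
    +-cong-~ {x} {y} {x′} {y′} (r , eq) (r′ , eq′) = r + r′ , (begin
      x + x′                       ≈⟨ +-cong eq eq′ ⟩
      y + r * g + (y′ + r′ * g)    ≈⟨ +-interchange _ _ _ _ ⟩
      y + y′ + (r * g + r′ * g)    ≈⟨ +-congˡ (sym (distribʳ g r r′)) ⟩
      y + y′ + (r + r′) * g        ∎)
      where
      open import Algebra.Properties.CommutativeSemigroup
        (CommutativeRing.+-commutativeSemigroup B)
        using () renaming (interchange to +-interchange)

    -- The cofactor comes from x x′ - y y′ = y (x′ - y′) + (x - y) x′.
    *-cong-~ : ∀ {x y x′ y′} → x ~ y → x′ ~ y′ → x * x′ ~ y * y′
    *-cong-~ {x} {y} {x′} {y′} (r , eq) (r′ , eq′) = y * r′ + r * x′ , (begin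
      x * x′                                 ≈⟨ *-congʳ eq ⟩
      (y + r * g) * x′                       ≈⟨ distribʳ x′ y (r * g) ⟩
      y * x′ + r * g * x′                    ≈⟨ +-cong (*-congˡ eq′) (xy∙z≈xz∙y r g x′) ⟩
      y * (y′ + r′ * g) + r * x′ * g         ≈⟨ +-congʳ (distribˡ y y′ (r′ * g)) ⟩
      y * y′ + y * (r′ * g) + r * x′ * g     ≈⟨ +-assoc _ _ _ ⟩
      y * y′ + (y * (r′ * g) + r * x′ * g)   ≈⟨ +-congˡ (+-congʳ (sym (*-assoc y r′ g))) ⟩
      y * y′ + (y * r′ * g + r * x′ * g)     ≈⟨ +-congˡ (sym (distribʳ g _ _)) ⟩
      y * y′ + (y * r′ + r * x′) * g         ∎)

    ^-cong-~ : ∀ {x y} n → x ~ y → x ^ n ~ y ^ n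
    ^-cong-~ zero    eq = ~-reflexive refl
    ^-cong-~ (suc n) eq = *-cong-~ eq (^-cong-~ n eq)

    monomial-cong-~ : ∀ {n} {b b′ : Fin n → Carrier} → (∀ i → b i ~ b′ i) →
                      ∀ m → monomial b m ~ monomial b′ m
    monomial-cong-~ eq []      = ~-reflexive refl
    monomial-cong-~ eq (j ∷ m) = *-cong-~ (^-cong-~ j (eq zero)) (monomial-cong-~ (eq ∘ suc) m)

module _ {a ℓᵃ b ℓᵇ : Level} (A : CommutativeRing a ℓᵃ) (B : CommutativeRing b ℓᵇ) where

  private
    module A = CommutativeRing A
    module B = CommutativeRing B
    module Aˢ = ListSum A.commutativeSemiring
    module Bˢ = ListSum B.commutativeSemiring
    module A^ = Algebra.Properties.Semiring.Exp A.semiring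
    module B^ = Algebra.Properties.Semiring.Exp B.semiring

  IsHom : (A.Carrier → B.Carrier) → Set (a ⊔ ℓᵃ ⊔ ℓᵇ)
  IsHom = RingMorphisms.IsRingHomomorphism A.rawRing B.rawRing

  module _ (h : A.Carrier → B.Carrier) (isHom : IsHom h) where

    open RingMorphisms.IsRingHomomorphism isHom

    ∑-homo : ∀ {i} {I : Set i} (g : I → A.Carrier) xs → h (Aˢ.∑ g xs) B.≈ Bˢ.∑ (h ∘ g) xs
    ∑-homo g []       = 0#-homo
    ∑-homo g (x ∷ xs) = B.trans (+-homo _ _) (B.+-congˡ (∑-homo g xs))

    ^-homo : ∀ x n → h (x A^.^ n) B.≈ h x B^.^ n
    ^-homo x zero    = 1#-homo
    ^-homo x (suc n) = B.trans (*-homo _ _) (B.*-congˡ (^-homo x n))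

    monomial-homo : ∀ {n} (b : Fin n → A.Carrier) m → h (monomial A b m) B.≈ monomial B (h ∘ b) m
    monomial-homo b []      = 1#-homo
    monomial-homo b (j ∷ m) =
      B.trans (*-homo _ _) (B.*-cong (^-homo (b zero) j) (monomial-homo (b ∘ suc) m))

-- Linear maps on polynomials given as lists of terms

module Polynomials {k ℓ₁ ℓ₂ : Level} (K : HeytingField k ℓ₁ ℓ₂) where

  R : CommutativeRing k ℓ₁
  R = record { isCommutativeRing = HeytingField.isCommutativeRing K }

  module R = CommutativeRing R

  module _ {n : ℕ} where
    open Logarithmic K n public
      using (coeff; _≈ˢ_; 0ˢ; _+ˢ_; _*ˢ_; -ˢ_; _·ˢ_; ∂; IsHomogeneous; _⟪_⟫; coeff-+; coeff-·; coeff-neg)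

  S : ℕ → Set k
  S n = Logarithmic.S K n

  infix 4 _≋_
  -- _≈ˢ_ as a record, so that the polynomials can be inferred from it.
  record _≋_ {n} (p q : S n) : Set ℓ₁ where
    constructor mk
    field coeff-≈ : p ≈ˢ q
  open _≋_ public

  _≟ᵐ_ : ∀ {n} (m m′ : Vec ℕ n) → Dec (m ≡ m′)
  _≟ᵐ_ = Vec.≡-dec ℕ._≟_

  module LinearExtension {b ℓ : Level} (B : CommutativeRing b ℓ)
    (ι : R.Carrier → CommutativeRing.Carrier B) (ι-hom : IsHom R B ι) (n : ℕ) where

    open CommutativeRing B hiding (zero)
    open ListSum commutativeSemiring
    open RingMorphisms.IsRingHomomorphism ι-hom
    open import Algebra.Properties.Ring ring using (-‿distribˡ-*; -0#≈0#; -‿+-comm; x∙y⁻¹≈ε⇒x≈y)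
    open import Algebra.Properties.CommutativeSemigroup (CommutativeRing.+-commutativeSemigroup B)
      using (x∙yz≈y∙xz)
    open import Relation.Binary.Reasoning.Setoid setoid

    term : (Vec ℕ n → Carrier) → R.Carrier × Vec ℕ n → Carrier
    term g (a , m) = ι a * g m

    -- The common form of linear functionals (`B` the field) and of substitutions (`B` a polynomial
    -- ring). It is defined on lists of terms, so its compatibility with equality of coefficients,
    -- `lin-congʳ`, has to be proved once and then serves both.
    lin : (Vec ℕ n → Carrier) → S n → Carrier
    lin g = ∑ (term g)

    lin-congˡ : ∀ {g h} p → (∀ m → g m ≈ h m) → lin g p ≈ lin h p
    lin-congˡ p eq = ∑-cong p (λ (_ , m) → *-congˡ (eq m))

    lin-+ : ∀ g p q → lin g (p +ˢ q) ≈ lin g p + lin g q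
    lin-+ g = ∑-++ (term g)

    lin-neg : ∀ g p → lin g (-ˢ p) ≈ - lin g p
    lin-neg g []            = sym -0#≈0#
    lin-neg g ((a , m) ∷ p) = begin
      ι (R.- a) * g m + lin g (-ˢ p)
        ≈⟨ +-cong (trans (*-congʳ (-‿homo a)) (sym (-‿distribˡ-* _ _))) (lin-neg g p) ⟩
      - (ι a * g m) + - lin g p        ≈⟨ -‿+-comm _ _ ⟩
      - (ι a * g m + lin g p)          ∎

    lin-· : ∀ g a p → lin g (a ·ˢ p) ≈ ι a * lin g p
    lin-· g a p = begin
      ∑ (term g) (a ·ˢ p)                        ≈⟨ ∑-map (term g) _ p ⟩
      ∑ (λ (b , m) → ι (a R.* b) * g m) p
        ≈⟨ ∑-cong p (λ (b , m) → trans (*-congʳ (*-homo a b)) (*-assoc _ _ _)) ⟩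
      ∑ (λ (b , m) → ι a * (ι b * g m)) p        ≈⟨ sym (*-distribˡ-∑ (ι a) (term g) p) ⟩
      ι a * ∑ (term g) p                         ∎

    -- The product now enters only through `⊕` inside `g`, so the laws of polynomial multiplication
    -- reduce to those of `⊕` and to interchanging sums.
    lin-* : ∀ g p q → lin g (p *ˢ q) ≈ lin (λ m → lin (λ m′ → g (m ⊕ m′)) q) p
    lin-* g []            q = refl
    lin-* g ((a , m) ∷ p) q = begin
      lin g (List.map (λ (b , m′) → a R.* b , m ⊕ m′) q ++ p *ˢ q)
        ≈⟨ lin-+ g (List.map (λ (b , m′) → a R.* b , m ⊕ m′) q) (p *ˢ q) ⟩
      lin g (List.map (λ (b , m′) → a R.* b , m ⊕ m′) q) + lin g (p *ˢ q)
        ≈⟨ +-cong head (lin-* g p q) ⟩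
      ι a * lin (λ m′ → g (m ⊕ m′)) q + lin (λ m → lin (λ m′ → g (m ⊕ m′)) q) p ∎
      where
      head : lin g (List.map (λ (b , m′) → a R.* b , m ⊕ m′) q) ≈ ι a * lin (λ m′ → g (m ⊕ m′)) q
      head = begin
        lin g (List.map (λ (b , m′) → a R.* b , m ⊕ m′) q)
          ≈⟨ ∑-map (term g) _ q ⟩
        ∑ (λ (b , m′) → ι (a R.* b) * g (m ⊕ m′)) q
          ≈⟨ ∑-cong q (λ (b , m′) → trans (*-congʳ (*-homo a b)) (*-assoc _ _ _)) ⟩
        ∑ (λ (b , m′) → ι a * (ι b * g (m ⊕ m′))) q
          ≈⟨ sym (*-distribˡ-∑ (ι a) (term (λ m′ → g (m ⊕ m′))) q) ⟩
        ι a * lin (λ m′ → g (m ⊕ m′)) q ∎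

    lin-comm : ∀ (g : Vec ℕ n → Vec ℕ n → Carrier) p q →
               lin (λ m → lin (g m) q) p ≈ lin (λ m′ → lin (λ m → g m m′) p) q
    lin-comm g p q = begin
      ∑ (λ (a , m) → ι a * ∑ (λ (b , m′) → ι b * g m m′) q) p
        ≈⟨ ∑-cong p (λ (a , m) → *-distribˡ-∑ (ι a) (term (g m)) q) ⟩
      ∑ (λ (a , m) → ∑ (λ (b , m′) → ι a * (ι b * g m m′)) q) p
        ≈⟨ ∑-comm (λ (a , m) (b , m′) → ι a * (ι b * g m m′)) p q ⟩
      ∑ (λ (b , m′) → ∑ (λ (a , m) → ι a * (ι b * g m m′)) p) q
        ≈⟨ ∑-cong q (λ (b , m′) → ∑-cong p (λ (a , m) → *-swap _ _ _)) ⟩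
      ∑ (λ (b , m′) → ∑ (λ (a , m) → ι b * (ι a * g m m′)) p) q
        ≈⟨ ∑-cong q (λ (b , m′) → sym (*-distribˡ-∑ (ι b) (term (λ m → g m m′)) p)) ⟩
      ∑ (λ (b , m′) → ι b * ∑ (λ (a , m) → ι a * g m m′) p) q ∎
      where
      open import Algebra.Properties.CommutativeSemigroup *-commutativeSemigroup
        using () renaming (x∙yz≈y∙xz to *-swap)

    private
      _≢?_ : ∀ (e : R.Carrier × Vec ℕ n) m → Dec (proj₂ e ≢ m)
      e ≢? m = ¬? (proj₂ e ≟ᵐ m)

      remove : Vec ℕ n → S n → S n
      remove m = List.filter (_≢? m)

      coeff-remove-≡ : ∀ m p → coeff (remove m p) m R.≈ R.0#
      coeff-remove-≡ m []             = R.refl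
      coeff-remove-≡ m ((a , m′) ∷ p) with m′ ≟ᵐ m in eq
      ... | yes _ = coeff-remove-≡ m p
      ... | no _ rewrite eq = R.trans (R.+-identityˡ _) (coeff-remove-≡ m p)

      coeff-remove-≢ : ∀ m p m′ → m ≢ m′ → coeff (remove m p) m′ R.≈ coeff p m′
      coeff-remove-≢ m []             m′ m≢m′ = R.refl
      coeff-remove-≢ m ((a , m″) ∷ p) m′ m≢m′ with m″ ≟ᵐ m
      ... | no _       = R.+-congˡ (coeff-remove-≢ m p m′ m≢m′)
      ... | yes ≡.refl = R.trans (coeff-remove-≢ m p m′ m≢m′)
        (R.sym (R.trans (R.+-congʳ (R.reflexive
          (≡.cong (λ b → if b then a else R.0#) (dec-false (m ≟ᵐ m′) m≢m′)))) (R.+-identityˡ _)))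

    lin-remove : ∀ g m p → lin g p ≈ ι (coeff p m) * g m + lin g (remove m p)
    lin-remove g m []            = sym (trans (+-identityʳ _) (trans (*-congʳ 0#-homo) (zeroˡ _)))
    lin-remove g m ((a , m′) ∷ p) with m′ ≟ᵐ m
    ... | yes ≡.refl = begin
      ι a * g m + lin g p
        ≈⟨ +-congˡ (lin-remove g m p) ⟩
      ι a * g m + (ι (coeff p m) * g m + lin g (remove m p))
        ≈⟨ sym (+-assoc _ _ _) ⟩
      ι a * g m + ι (coeff p m) * g m + lin g (remove m p)
        ≈⟨ +-congʳ (sym (trans (*-congʳ (+-homo a _)) (distribʳ _ _ _))) ⟩
      ι (a R.+ coeff p m) * g m + lin g (remove m p) ∎
    ... | no _ = begin
      ι a * g m′ + lin g p
        ≈⟨ +-congˡ (lin-remove g m p) ⟩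
      ι a * g m′ + (ι (coeff p m) * g m + lin g (remove m p))
        ≈⟨ x∙yz≈y∙xz _ _ _ ⟩
      ι (coeff p m) * g m + (ι a * g m′ + lin g (remove m p))
        ≈⟨ +-congʳ (*-congʳ (⟦⟧-cong (R.sym (R.+-identityˡ _)))) ⟩
      ι (R.0# R.+ coeff p m) * g m + (ι a * g m′ + lin g (remove m p)) ∎

    private
      -- Collecting all terms with the exponent of the first one replaces them by a single product,
      -- zero by assumption, and leaves a shorter list. That list is a filtered one, so the
      -- recursion runs on a bound for its length. Vanishing is assumed of the products, so that for
      -- each exponent either the coefficient or the value of `g` may be the zero factor.
      lin-vanish-fuel : ∀ g fuel p → List.length p ≤ fuel →
                        (∀ m → ι (coeff p m) * g m ≈ 0#) → lin g p ≈ 0#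
      lin-vanish-fuel g _          []                _        _      = refl
      lin-vanish-fuel g (suc fuel) p@((a , m) ∷ p′) (s≤s le) vanish = begin
        lin g p                                    ≈⟨ lin-remove g m p ⟩
        ι (coeff p m) * g m + lin g (remove m p)   ≈⟨ +-cong (vanish m) rest ⟩
        0# + 0#                                    ≈⟨ +-identityʳ 0# ⟩
        0#                                         ∎
        where
        -- The first term is among those removed, which makes the bound drop.
        shorter : List.length (remove m p) ≤ fuel
        shorter rewrite List.filter-reject (_≢? m) {x = a , m} {xs = p′} (λ ≢ → ≢ ≡.refl) =
          ℕ.≤-trans (List.length-filter (_≢? m) p′) le
        rest : lin g (remove m p) ≈ 0#
        rest = lin-vanish-fuel g fuel (remove m p) shorter vanish′
          where
          vanish′ : ∀ m′ → ι (coeff (remove m p) m′) * g m′ ≈ 0#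
          vanish′ m′ with m ≟ᵐ m′
          ... | yes ≡.refl = trans
            (*-congʳ (trans (⟦⟧-cong (coeff-remove-≡ m p)) 0#-homo)) (zeroˡ _)
          ... | no m≢m′    = trans (*-congʳ (⟦⟧-cong (coeff-remove-≢ m p m′ m≢m′))) (vanish m′)

    lin-vanish : ∀ g p → (∀ m → ι (coeff p m) * g m ≈ 0#) → lin g p ≈ 0#
    lin-vanish g p = lin-vanish-fuel g (List.length p) p ℕ.≤-refl

    lin-congʳ : ∀ g {p q} → p ≋ q → lin g p ≈ lin g q
    lin-congʳ g {p} {q} (mk p≈q) = x∙y⁻¹≈ε⇒x≈y _ _ (begin
      lin g p + - lin g q        ≈⟨ +-congˡ (sym (lin-neg g q)) ⟩
      lin g p + lin g (-ˢ q)     ≈⟨ sym (lin-+ g p (-ˢ q)) ⟩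
      lin g (p +ˢ -ˢ q)          ≈⟨ lin-vanish g (p +ˢ -ˢ q) (λ m → trans (*-congʳ (trans
        (⟦⟧-cong (R.trans (coeff-+ p (-ˢ q) m) (R.trans (R.+-cong (p≈q m) (coeff-neg q m))
          (R.-‿inverseʳ _))))
        0#-homo)) (zeroˡ _)) ⟩
      0#                         ∎)

  -- The commutative ring of polynomials

  id-hom : IsHom R R id
  id-hom = Identity.isRingHomomorphism R.rawRing R.refl

  module Scalar (n : ℕ) = LinearExtension R id id-hom n

  module _ {n : ℕ} where
    open Scalar n public

  δ : ∀ {n} → Vec ℕ n → Vec ℕ n → R.Carrier
  δ m m′ = if does (m′ ≟ᵐ m) then R.1# else R.0#

  δ-≡ : ∀ {n} (m : Vec ℕ n) → δ m m ≡ R.1#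
  δ-≡ m = ≡.cong (if_then R.1# else R.0#) (dec-true (m ≟ᵐ m) ≡.refl)

  δ-≢ : ∀ {n} {m m′ : Vec ℕ n} → m′ ≢ m → δ m m′ ≡ R.0#
  δ-≢ {m = m} {m′} ≢ = ≡.cong (if_then R.1# else R.0#) (dec-false (m′ ≟ᵐ m) ≢)

  coeff≈lin : ∀ {n} (p : S n) m → coeff p m R.≈ lin (δ m) p
  coeff≈lin []             m = R.refl
  coeff≈lin ((a , m′) ∷ p) m with does (m′ ≟ᵐ m)
  ... | true  = R.+-cong (R.sym (R.*-identityʳ a)) (coeff≈lin p m)
  ... | false = R.+-cong (R.sym (R.zeroʳ a)) (coeff≈lin p m)

  -- Coefficients are themselves linear functionals, namely those extending `δ m`. Identities
  -- between polynomials can therefore be checked on an arbitrary functional, without rearranging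
  -- lists.
  ≋-ext : ∀ {n} {p q : S n} → (∀ g → lin g p R.≈ lin g q) → p ≋ q
  ≋-ext {p = p} {q} eq = mk λ m →
    R.trans (coeff≈lin p m) (R.trans (eq (δ m)) (R.sym (coeff≈lin q m)))

  const-poly : ∀ {n} → R.Carrier → S n
  const-poly a = (a , 𝟎) ∷ []

  1ˢ : ∀ {n} → S n
  1ˢ = const-poly R.1#

  +ˢ-cong : ∀ {n} {p p′ q q′ : S n} → p ≋ p′ → q ≋ q′ → p +ˢ q ≋ p′ +ˢ q′
  +ˢ-cong {p = p} {p′} {q} {q′} (mk eq) (mk eq′) = mk λ m →
    R.trans (coeff-+ p q m) (R.trans (R.+-cong (eq m) (eq′ m)) (R.sym (coeff-+ p′ q′ m)))

  +ˢ-comm : ∀ {n} (p q : S n) → p +ˢ q ≋ q +ˢ p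
  +ˢ-comm p q = mk λ m → R.trans (coeff-+ p q m) (R.trans (R.+-comm _ _) (R.sym (coeff-+ q p m)))

  -ˢ-cong : ∀ {n} {p q : S n} → p ≋ q → -ˢ p ≋ -ˢ q
  -ˢ-cong {p = p} {q} (mk eq) = mk λ m →
    R.trans (coeff-neg p m) (R.trans (R.-‿cong (eq m)) (R.sym (coeff-neg q m)))

  -ˢ-inverseʳ : ∀ {n} (p : S n) → p +ˢ -ˢ p ≋ 0ˢ
  -ˢ-inverseʳ p = mk λ m →
    R.trans (coeff-+ p (-ˢ p) m) (R.trans (R.+-congˡ (coeff-neg p m)) (R.-‿inverseʳ _))

  module _ {n : ℕ} where

    open import Relation.Binary.Reasoning.Setoid R.setoid

    *ˢ-cong : {p p′ q q′ : S n} → p ≋ p′ → q ≋ q′ → p *ˢ q ≋ p′ *ˢ q′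
    *ˢ-cong {p} {p′} {q} {q′} eq eq′ = ≋-ext λ g → begin
      lin g (p *ˢ q)                              ≈⟨ lin-* g p q ⟩
      lin (λ m → lin (λ m′ → g (m ⊕ m′)) q) p     ≈⟨ lin-congˡ p (λ m → lin-congʳ _ eq′) ⟩
      lin (λ m → lin (λ m′ → g (m ⊕ m′)) q′) p    ≈⟨ lin-congʳ _ eq ⟩
      lin (λ m → lin (λ m′ → g (m ⊕ m′)) q′) p′   ≈⟨ R.sym (lin-* g p′ q′) ⟩
      lin g (p′ *ˢ q′)                            ∎

    *ˢ-comm : (p q : S n) → p *ˢ q ≋ q *ˢ p
    *ˢ-comm p q = ≋-ext λ g → begin
      lin g (p *ˢ q)                              ≈⟨ lin-* g p q ⟩
      lin (λ m → lin (λ m′ → g (m ⊕ m′)) q) p     ≈⟨ lin-comm _ p q ⟩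
      lin (λ m′ → lin (λ m → g (m ⊕ m′)) p) q
        ≈⟨ lin-congˡ q (λ m′ → lin-congˡ p (λ m → R.reflexive (≡.cong g (⊕-comm m m′)))) ⟩
      lin (λ m′ → lin (λ m → g (m′ ⊕ m)) p) q     ≈⟨ R.sym (lin-* g q p) ⟩
      lin g (q *ˢ p)                              ∎

    *ˢ-assoc : (p q r : S n) → (p *ˢ q) *ˢ r ≋ p *ˢ (q *ˢ r)
    *ˢ-assoc p q r = ≋-ext λ g → begin
      lin g ((p *ˢ q) *ˢ r)
        ≈⟨ lin-* g (p *ˢ q) r ⟩
      lin (λ m → lin (λ m″ → g (m ⊕ m″)) r) (p *ˢ q)
        ≈⟨ lin-* _ p q ⟩
      lin (λ m → lin (λ m′ → lin (λ m″ → g ((m ⊕ m′) ⊕ m″)) r) q) p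
        ≈⟨ lin-congˡ p (λ m → lin-congˡ q (λ m′ → lin-congˡ r
             (λ m″ → R.reflexive (≡.cong g (⊕-assoc m m′ m″))))) ⟩
      lin (λ m → lin (λ m′ → lin (λ m″ → g (m ⊕ (m′ ⊕ m″))) r) q) p
        ≈⟨ lin-congˡ p (λ m → R.sym (lin-* _ q r)) ⟩
      lin (λ m → lin (λ m′ → g (m ⊕ m′)) (q *ˢ r)) p
        ≈⟨ R.sym (lin-* g p (q *ˢ r)) ⟩
      lin g (p *ˢ (q *ˢ r)) ∎

    const-poly-*ˢ : ∀ a (p : S n) → const-poly a *ˢ p ≋ a ·ˢ p
    const-poly-*ˢ a p = ≋-ext λ g → begin
      lin g (const-poly a *ˢ p)          ≈⟨ lin-* g (const-poly a) p ⟩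
      a R.* lin (λ m → g (𝟎 ⊕ m)) p R.+ R.0#
                                         ≈⟨ R.+-identityʳ _ ⟩
      a R.* lin (λ m → g (𝟎 ⊕ m)) p
        ≈⟨ R.*-congˡ (lin-congˡ p (λ m → R.reflexive (≡.cong g (⊕-identityˡ m)))) ⟩
      a R.* lin g p                      ≈⟨ R.sym (lin-· g a p) ⟩
      lin g (a ·ˢ p)                     ∎

    *ˢ-identityˡ : (p : S n) → 1ˢ *ˢ p ≋ p
    *ˢ-identityˡ p = mk λ m →
      R.trans (coeff-≈ (const-poly-*ˢ R.1# p) m) (R.trans (coeff-· R.1# p m) (R.*-identityˡ _))

    *ˢ-distribʳ : (r p q : S n) → (p +ˢ q) *ˢ r ≋ p *ˢ r +ˢ q *ˢ r
    *ˢ-distribʳ r p q = ≋-ext λ g → begin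
      lin g ((p +ˢ q) *ˢ r)              ≈⟨ lin-* g (p +ˢ q) r ⟩
      lin _ (p +ˢ q)                     ≈⟨ lin-+ _ p q ⟩
      lin _ p R.+ lin _ q                ≈⟨ R.+-cong (R.sym (lin-* g p r)) (R.sym (lin-* g q r)) ⟩
      lin g (p *ˢ r) R.+ lin g (q *ˢ r)  ≈⟨ R.sym (lin-+ g (p *ˢ r) (q *ˢ r)) ⟩
      lin g (p *ˢ r +ˢ q *ˢ r)           ∎

  polynomialRing : ℕ → CommutativeRing k ℓ₁
  polynomialRing n = record
    { Carrier = S n
    ; _≈_ = _≋_
    ; _+_ = _+ˢ_
    ; _*_ = _*ˢ_
    ; -_ = -ˢ_
    ; 0# = 0ˢ
    ; 1# = 1ˢ
    ; isCommutativeRing = record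
      { isRing = record
        { +-isAbelianGroup = record
          { isGroup = record
            { isMonoid = record
              { isSemigroup = record
                { isMagma = record
                  { isEquivalence = ≋-isEquivalence
                  ; ∙-cong = +ˢ-cong
                  }
                ; assoc = λ p q r → ≋-reflexive (List.++-assoc p q r)
                }
              ; identity = (λ _ → ≋-reflexive ≡.refl) , λ p → ≋-reflexive (List.++-identityʳ p)
              }
            ; inverse = comm∧invʳ⇒inv +ˢ-comm -ˢ-inverseʳ
            ; ⁻¹-cong = -ˢ-cong
            }
          ; comm = +ˢ-comm
          }
        ; *-cong = *ˢ-cong
        ; *-assoc = *ˢ-assoc
        ; *-identity = comm∧idˡ⇒id *ˢ-comm *ˢ-identityˡ
        ; distrib = comm∧distrʳ⇒distr +ˢ-cong *ˢ-comm *ˢ-distribʳ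
        }
      ; *-comm = *ˢ-comm
      }
    }
    where
    ≋-isEquivalence : IsEquivalence (_≋_ {n})
    ≋-isEquivalence = record
      { refl  = mk λ _ → R.refl
      ; sym   = λ (mk e) → mk λ m → R.sym (e m)
      ; trans = λ (mk e) (mk e′) → mk λ m → R.trans (e m) (e′ m)
      }
    ≋-reflexive : {p q : S n} → p ≡ q → p ≋ q
    ≋-reflexive = IsEquivalence.reflexive ≋-isEquivalence
    ≋-setoid : Setoid k ℓ₁
    ≋-setoid = record { isEquivalence = ≋-isEquivalence }
    open import Algebra.Consequences.Setoid ≋-setoid using
      (comm∧idˡ⇒id; comm∧invʳ⇒inv; comm∧distrʳ⇒distr)

-- Substitution, degrees and supports

open import Algebra.Properties.CommutativeSemigroup ℕ.+-commutativeSemigroup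
  using () renaming (interchange to ℕ-interchange)

sum-⊕ : ∀ {n} (m m′ : Vec ℕ n) → Vec.sum (m ⊕ m′) ≡ Vec.sum m ℕ.+ Vec.sum m′
sum-⊕ []      []        = ≡.refl
sum-⊕ (j ∷ m) (j′ ∷ m′) =
  ≡.trans (≡.cong (j ℕ.+ j′ ℕ.+_) (sum-⊕ m m′)) (ℕ-interchange j j′ (Vec.sum m) (Vec.sum m′))

sum-𝟎 : ∀ n → Vec.sum (𝟎 {n}) ≡ 0
sum-𝟎 zero    = ≡.refl
sum-𝟎 (suc n) = sum-𝟎 n

sum-unit : ∀ {n} (i : Fin n) → Vec.sum (unit i) ≡ 1
sum-unit {suc n} zero    = ≡.cong suc (sum-𝟎 n)
sum-unit {suc n} (suc i) = sum-unit i

module PolynomialMaps {k ℓ₁ ℓ₂ : Level} (K : HeytingField k ℓ₁ ℓ₂) where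

  open Polynomials K

  module Sᴿ {n : ℕ} = CommutativeRing (polynomialRing n)

  *ˢ-congˡ : ∀ {n} (r : S n) {p q} → p ≋ q → r *ˢ p ≋ r *ˢ q
  *ˢ-congˡ r = *ˢ-cong {p = r} Sᴿ.refl

  const-poly-hom : ∀ {n} → IsHom R (polynomialRing n) const-poly
  const-poly-hom {n} = record
    { isSemiringHomomorphism = record
      { isNearSemiringHomomorphism = record
        { +-isMonoidHomomorphism = record
          { isMagmaHomomorphism = record
            { isRelHomomorphism = record
              { cong = λ eq → ≋-ext λ g → R.+-congʳ (R.*-congʳ eq) }
            ; homo = λ a b → ≋-ext λ g →
                R.trans (R.+-congʳ (R.distribʳ _ a b)) (R.+-assoc _ _ _)
            }
          ; ε-homo = ≋-ext λ g → R.trans (R.+-identityʳ _) (R.zeroˡ _)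
          }
        ; *-homo = λ a b → Sᴿ.sym (Sᴿ.trans (const-poly-*ˢ a (const-poly b)) Sᴿ.refl)
        }
      ; 1#-homo = Sᴿ.refl
      }
    ; -‿homo = λ a → Sᴿ.refl
    }

  module Polynomial (n′ n : ℕ) =
    LinearExtension (polynomialRing n′) const-poly const-poly-hom n

  x : ∀ {n} → Fin n → S n
  x {n} = Logarithmic.x K n

  X^_ : ∀ {n} → Vec ℕ n → S n
  X^ m = (R.1# , m) ∷ []

  module _ {n′ n : ℕ} where

    private module L = Polynomial n′ n

    coeff-lin : ∀ (g : Vec ℕ n → S n′) p m → coeff (L.lin g p) m R.≈ lin (λ m′ → coeff (g m′) m) p
    coeff-lin g []             m = R.refl
    coeff-lin g ((a , m′) ∷ p) m = begin
      coeff (const-poly a *ˢ g m′ +ˢ L.lin g p) m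
        ≈⟨ coeff-+ (const-poly a *ˢ g m′) (L.lin g p) m ⟩
      coeff (const-poly a *ˢ g m′) m R.+ coeff (L.lin g p) m
        ≈⟨ R.+-cong (R.trans (coeff-≈ (const-poly-*ˢ a (g m′)) m) (coeff-· a (g m′) m))
             (coeff-lin g p m) ⟩
      a R.* coeff (g m′) m R.+ lin (λ m′ → coeff (g m′) m) p ∎
      where open import Relation.Binary.Reasoning.Setoid R.setoid

    substitute : (Fin n → S n′) → S n → S n′
    substitute b = L.lin (monomial (polynomialRing n′) b)

    module _ (b : Fin n → S n′) where

      open import Relation.Binary.Reasoning.Setoid (CommutativeRing.setoid (polynomialRing n′))
      open ListSum (Sᴿ.commutativeSemiring {n′}) using (∑-cong; *-distribˡ-∑)

      substitute-X^ : ∀ m → substitute b (X^ m) ≋ monomial (polynomialRing n′) b m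
      substitute-X^ m = Sᴿ.trans (Sᴿ.+-identityʳ _) (Sᴿ.*-identityˡ _)

      substitute-x : ∀ i → substitute b (x i) ≋ b i
      substitute-x i = Sᴿ.trans (substitute-X^ (unit i)) (monomial-unit (polynomialRing n′) b i)

      substitute-const : ∀ a → substitute b (const-poly a) ≋ const-poly a
      substitute-const a = begin
        const-poly a *ˢ monomial (polynomialRing n′) b 𝟎 +ˢ 0ˢ  ≈⟨ Sᴿ.+-identityʳ _ ⟩
        const-poly a *ˢ monomial (polynomialRing n′) b 𝟎
          ≈⟨ *ˢ-congˡ (const-poly a) (monomial-𝟎 (polynomialRing n′) b) ⟩
        const-poly a *ˢ 1ˢ                                       ≈⟨ Sᴿ.*-identityʳ _ ⟩
        const-poly a                                             ∎

      private
        bᵐ : Vec ℕ n → S n′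
        bᵐ = monomial (polynomialRing n′) b

      substitute-* : ∀ p q → substitute b (p *ˢ q) ≋ substitute b p *ˢ substitute b q
      substitute-* p q = begin
        substitute b (p *ˢ q)
          ≈⟨ L.lin-* bᵐ p q ⟩
        L.lin (λ m → L.lin (λ m′ → bᵐ (m ⊕ m′)) q) p
          ≈⟨ L.lin-congˡ p (λ m → Sᴿ.trans
               (L.lin-congˡ q (λ m′ → monomial-⊕ (polynomialRing n′) b m m′)) (pull (bᵐ m) bᵐ q)) ⟩
        L.lin (λ m → bᵐ m *ˢ substitute b q) p
          ≈⟨ L.lin-congˡ p (λ m → *ˢ-comm (bᵐ m) (substitute b q)) ⟩
        L.lin (λ m → substitute b q *ˢ bᵐ m) p
          ≈⟨ pull (substitute b q) bᵐ p ⟩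
        substitute b q *ˢ substitute b p
          ≈⟨ *ˢ-comm (substitute b q) (substitute b p) ⟩
        substitute b p *ˢ substitute b q ∎
        where
        open import Algebra.Properties.CommutativeSemigroup
          (CommutativeRing.*-commutativeSemigroup (polynomialRing n′))
          using (x∙yz≈y∙xz)
        pull : ∀ r g q → L.lin (λ m → r *ˢ g m) q ≋ r *ˢ L.lin g q
        pull r g q = Sᴿ.trans (∑-cong q (λ (a , m) → x∙yz≈y∙xz (const-poly a) r (g m)))
                              (Sᴿ.sym (*-distribˡ-∑ r (λ (a , m) → const-poly a *ˢ g m) q))

      substitute-hom : IsHom (polynomialRing n) (polynomialRing n′) (substitute b)
      substitute-hom = record
        { isSemiringHomomorphism = record
          { isNearSemiringHomomorphism = record
            { +-isMonoidHomomorphism = record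
              { isMagmaHomomorphism = record
                { isRelHomomorphism = record { cong = L.lin-congʳ _ }
                ; homo = L.lin-+ _
                }
              ; ε-homo = Sᴿ.refl
              }
            ; *-homo = substitute-*
            }
          ; 1#-homo = substitute-const R.1#
          }
        ; -‿homo = L.lin-neg _
        }

  substitute-∘ : ∀ {n n′ n″} (b : Fin n′ → S n″) (b′ : Fin n → S n′) p →
                 substitute b (substitute b′ p) ≋ substitute (substitute b ∘ b′) p
  substitute-∘ {n} {n′} {n″} b b′ p = Sᴿ.trans
    (∑-homo (polynomialRing n′) (polynomialRing n″) (substitute b) hom _ p)
    (ListSum.∑-cong Sᴿ.commutativeSemiring p λ (a , m) → Sᴿ.trans
      (substitute-* b (const-poly a) (monomial (polynomialRing n′) b′ m))
      (*ˢ-cong (substitute-const b a) (monomial-homo (polynomialRing n′) (polynomialRing n″)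
        (substitute b) hom b′ m)))
    where
    hom : IsHom (polynomialRing n′) (polynomialRing n″) (substitute b)
    hom = substitute-hom b

  substitute-cong : ∀ {n n′} {b b′ : Fin n → S n′} → (∀ i → b i ≋ b′ i) →
                    ∀ p → substitute b p ≋ substitute b′ p
  substitute-cong {n} {n′} eq p =
    Polynomial.lin-congˡ n′ n p (monomial-cong (polynomialRing n′) eq)

  X^-⊕ : ∀ {n} (m m′ : Vec ℕ n) → X^ (m ⊕ m′) ≋ X^ m *ˢ X^ m′
  X^-⊕ m m′ = ≋-ext λ g → R.+-congʳ (R.*-congʳ (R.sym (R.*-identityˡ R.1#)))

  -- Products of single terms are single terms with added exponents, so the claim reduces to `m`
  -- being the combination of the unit vectors with the entries of `m` as multiplicities.
  monomial-x : ∀ {n} (m : Vec ℕ n) → monomial (polynomialRing n) x m ≋ X^ m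
  monomial-x {n} m = Sᴿ.trans (go unit m) (Sᴿ.reflexive (≡.cong X^_ (combination-unit m)))
    where
    open import Algebra.Properties.Semiring.Exp (Sᴿ.semiring {n})

    times : ∀ {n} → ℕ → Vec ℕ n → Vec ℕ n
    times zero    e = 𝟎
    times (suc j) e = e ⊕ times j e

    combination : ∀ {n n′} → (Fin n′ → Vec ℕ n) → Vec ℕ n′ → Vec ℕ n
    combination e []      = 𝟎
    combination e (j ∷ m) = times j (e zero) ⊕ combination (e ∘ suc) m

    X^-times : ∀ j (e : Vec ℕ n) → X^ e ^ j ≋ X^ times j e
    X^-times zero    e = Sᴿ.refl
    X^-times (suc j) e = Sᴿ.trans (*ˢ-congˡ (X^ e) (X^-times j e)) (Sᴿ.sym (X^-⊕ e (times j e)))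

    -- General in `e`, since the recursion passes to `e ∘ suc` while the ambient number of variables
    -- stays `n`.
    go : ∀ {n′} (e : Fin n′ → Vec ℕ n) m →
      monomial (polynomialRing n) (X^_ ∘ e) m ≋ X^ combination e m
    go e []      = Sᴿ.refl
    go e (j ∷ m) = Sᴿ.trans (Sᴿ.*-cong (X^-times j (e zero)) (go (e ∘ suc) m))
                            (Sᴿ.sym (X^-⊕ (times j (e zero)) (combination (e ∘ suc) m)))

    times-unit : ∀ {n} j → times j (unit {suc n} zero) ≡ j ∷ 𝟎
    times-unit zero    = ≡.refl
    times-unit (suc j) = ≡.trans (≡.cong (unit zero ⊕_) (times-unit j))
      (≡.cong (suc j ∷_) (⊕-identityˡ 𝟎))

    times-0∷ : ∀ {n} j (e : Vec ℕ n) → times j (0 ∷ e) ≡ 0 ∷ times j e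
    times-0∷ zero    e = ≡.refl
    times-0∷ (suc j) e = ≡.cong ((0 ∷ e) ⊕_) (times-0∷ j e)

    combination-0∷ : ∀ {n n′} (e : Fin n′ → Vec ℕ n) m →
                     combination (λ i → 0 ∷ e i) m ≡ 0 ∷ combination e m
    combination-0∷ e []      = ≡.refl
    combination-0∷ e (j ∷ m) = ≡.cong₂ _⊕_ (times-0∷ j (e zero)) (combination-0∷ (e ∘ suc) m)

    combination-unit : ∀ {n} (m : Vec ℕ n) → combination unit m ≡ m
    combination-unit []      = ≡.refl
    combination-unit (j ∷ m) = ≡.trans
      (≡.cong₂ _⊕_ (times-unit j) (≡.trans (combination-0∷ unit m)
        (≡.cong (0 ∷_) (combination-unit m))))
      (≡.cong₂ _∷_ (ℕ.+-identityʳ j) (⊕-identityˡ m))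

  substitute-id : ∀ {n} (p : S n) → substitute x p ≋ p
  substitute-id []            = Sᴿ.refl
  substitute-id ((a , m) ∷ p) = Sᴿ.+-cong {_}
    {const-poly a *ˢ monomial (polynomialRing _) x m} {(a , m) ∷ []} {substitute x p} {p}
    (Sᴿ.trans (*ˢ-congˡ (const-poly a) (monomial-x m)) (≋-ext λ g → R.+-congʳ
      (R.*-cong (R.*-identityʳ a) (R.reflexive (≡.cong g (⊕-identityˡ m))))))
    (substitute-id p)

  -- A condition on the listed terms, stronger than `IsHomogeneous`: cancelling terms of other
  -- degrees are excluded too. Explicit products satisfy it, and it passes through multiplication
  -- term by term.
  AllOfDegree : ∀ {n} → ℕ → S n → Set k
  AllOfDegree d = All (λ (_ , m) → Vec.sum m ≡ d)

  AllOfDegree⇒IsHomogeneous : ∀ {n d} {p : S n} → AllOfDegree d p → IsHomogeneous d p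
  AllOfDegree⇒IsHomogeneous {p = []}          []        m ≢d = R.refl
  AllOfDegree⇒IsHomogeneous {p = (a , m′) ∷ p} (eq ∷ all) m ≢d = R.trans
    (R.+-cong (R.reflexive (≡.cong (λ b → if b then a else R.0#)
      (dec-false (m′ ≟ᵐ m) λ { ≡.refl → ≢d eq })))
              (AllOfDegree⇒IsHomogeneous all m ≢d))
    (R.+-identityˡ R.0#)

  AllOfDegree-* : ∀ {n d e} {p q : S n} →
    AllOfDegree d p → AllOfDegree e q → AllOfDegree (d ℕ.+ e) (p *ˢ q)
  AllOfDegree-* {p = []}          []         allq = []
  AllOfDegree-* {p = (a , m) ∷ p} (eq ∷ all) allq = All.++⁺
    (All.map⁺ (All.map (λ {(_ , m′)} eq′ → ≡.trans (sum-⊕ m m′) (≡.cong₂ ℕ._+_ eq eq′)) allq))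
    (AllOfDegree-* all allq)

  AllOfDegree-x : ∀ {n} (i : Fin n) → AllOfDegree 1 (x i)
  AllOfDegree-x i = sum-unit i ∷ []

  AllOfDegree-neg : ∀ {n d} {p : S n} → AllOfDegree d p → AllOfDegree d (-ˢ p)
  AllOfDegree-neg = All.map⁺

  AllOfDegree-monomial : ∀ {n n′} {b : Fin n → S n′} → (∀ i → AllOfDegree 1 (b i)) →
                         ∀ m → AllOfDegree (Vec.sum m) (monomial (polynomialRing n′) b m)
  AllOfDegree-monomial {n′ = n′} b-linear []      = sum-𝟎 n′ ∷ []
  AllOfDegree-monomial {n′ = n′} {b} b-linear (j ∷ m) =
    AllOfDegree-* (power j) (AllOfDegree-monomial (b-linear ∘ suc) m)
    where
    open import Algebra.Properties.Semiring.Exp (Sᴿ.semiring {n′})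
    power : ∀ j → AllOfDegree j (b zero ^ j)
    power zero    = sum-𝟎 n′ ∷ []
    power (suc j) = AllOfDegree-* (b-linear zero) (power j)

  -- Only the coefficients of `p` are known to be homogeneous, so its list may contain cancelling
  -- terms of other degrees. Hence `lin-vanish`: an exponent of degree other than `d` has
  -- coefficient zero, and one of degree `d` has an image without terms at `m`.
  substitute-homogeneous : ∀ {n n′ d} {b : Fin n → S n′} → (∀ i → AllOfDegree 1 (b i)) →
                           ∀ p → IsHomogeneous d p → IsHomogeneous d (substitute b p)
  substitute-homogeneous {d = d} {b} b-linear p p-hom m ≢d = R.trans
    (coeff-lin (monomial (polynomialRing _) b) p m)
    (lin-vanish _ p vanish)
    where
    vanish : ∀ m′ → coeff p m′ R.* coeff (monomial (polynomialRing _) b m′) m R.≈ R.0#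
    vanish m′ with Vec.sum m′ ℕ.≟ d
    ... | yes ≡.refl = R.trans
      (R.*-congˡ (AllOfDegree⇒IsHomogeneous (AllOfDegree-monomial b-linear m′) m ≢d)) (R.zeroʳ _)
    ... | no ≢d′     = R.trans (R.*-congʳ (p-hom m′ ≢d′)) (R.zeroˡ _)

  open ListSum R.commutativeSemiring using (∑; ∑-map; ∑-select; ∑-zero)

  -- The support of `p` cannot be computed without deciding equality in `K`; a duplicate-free list
  -- containing it takes its place. With one term for each entry of that list, a polynomial equal to
  -- `p` arises, and `lin` respects equality.
  lin-support : ∀ {n} {ms : List (Vec ℕ n)} → Unique ms → ∀ p →
    (∀ m → m ∉ₗ ms → coeff p m R.≈ R.0#) →
                ∀ g → lin g p R.≈ ∑ (λ m → coeff p m R.* g m) ms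
  lin-support {ms = ms} unique p supported g =
    R.trans (lin-congʳ g p≋p′) (∑-map (term g) (λ m → coeff p m , m) ms)
    where
    open DecMembership _≟ᵐ_ using (_∈?_)
    p′ = List.map (λ m → coeff p m , m) ms
    coeff-p′ : ∀ m → coeff p′ m R.≈ ∑ (λ m′ → coeff p m′ R.* δ m m′) ms
    coeff-p′ m = R.trans (coeff≈lin p′ m) (∑-map (term (δ m)) (λ m → coeff p m , m) ms)
    p≋p′ : p ≋ p′
    p≋p′ = mk λ m → R.sym (R.trans (coeff-p′ m) (select m))
      where
      select : ∀ m → ∑ (λ m′ → coeff p m′ R.* δ m m′) ms R.≈ coeff p m
      select m with m ∈? ms
      ... | yes m∈ = R.trans
        (∑-select _ unique m∈ (λ {m′} _ ≢ → R.trans (R.*-congˡ (R.reflexive (δ-≢ ≢))) (R.zeroʳ _)))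
        (R.trans (R.*-congˡ (R.reflexive (δ-≡ m))) (R.*-identityʳ _))
      ... | no m∉  = R.trans
        (∑-zero ms λ {m′} m′∈ → R.trans (R.*-congˡ
          (R.reflexive (δ-≢ {m = m} {m′} λ { ≡.refl → m∉ m′∈ }))) (R.zeroʳ _))
        (R.sym (supported m m∉))

  coeff-X^ : ∀ {n} (m m′ : Vec ℕ n) → coeff (X^ m) m′ R.≈ δ m′ m
  coeff-X^ m m′ = R.trans (coeff≈lin (X^ m) m′) (R.trans (R.+-identityʳ _) (R.*-identityˡ _))

  -- Every exponent of a multiple of `x i` is positive at `i`. This is how a congruence modulo a
  -- variable is read off coefficients.
  coeff-*x : ∀ {n} (p : S n) i m → Vec.lookup m i ≡ 0 → coeff (p *ˢ x i) m R.≈ R.0#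
  coeff-*x p i m eq = R.trans (coeff≈lin (p *ˢ x i) m) (R.trans (lin-* (δ m) p (x i))
    (lin-vanish _ p λ m′ → R.trans (R.*-congˡ (vanish m′)) (R.zeroʳ _)))
    where
    vanish : ∀ m′ → lin (λ m″ → δ m (m′ ⊕ m″)) (x i) R.≈ R.0#
    vanish m′ = R.trans (R.+-identityʳ _) (R.trans (R.*-identityˡ _)
      (R.reflexive (δ-≢ {m = m} {m′ ⊕ unit i} λ { ≡.refl →
      positive (≡.trans (≡.sym (Vec.lookup-zipWith ℕ._+_ i m′ (unit i))) eq) })))
      where
      positive : ¬ (Vec.lookup m′ i ℕ.+ Vec.lookup (unit i) i ≡ 0)
      positive eq rewrite Vec.lookup∘update i 𝟎 1 = ℕ.m+1+n≢0 (Vec.lookup m′ i) eq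

  -- Derivations applied to differences of variables

  module _ {n : ℕ} where

    open import Algebra.Definitions.RawMonoid (R.+-rawMonoid) using () renaming (_×_ to _×ᴷ_)
    open import Algebra.Properties.Ring (Sᴿ.ring {n}) using (-‿distribʳ-*)
    open ListSum (Sᴿ.commutativeSemiring {n}) using (sum-select)
    open import Algebra.Properties.CommutativeMonoid.Sum (Sᴿ.+-commutativeMonoid {n})
      using (sum; sum-cong-≋; ∑-distrib-+)
    open import Relation.Binary.Reasoning.Setoid (Sᴿ.setoid {n})

    ∂-unit-≢ : ∀ {i u : Fin n} a → i ≢ u → ∂ i ((a , unit u) ∷ []) ≋ 0ˢ
    ∂-unit-≢ {i} {u} a i≢u = ≋-ext λ g → R.trans (R.+-identityʳ _)
      (R.trans (R.*-congʳ (R.reflexive (≡.cong (_×ᴷ a)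
        (≡.trans (Vec.lookup∘update′ i≢u 𝟎 1) (Vec.lookup-replicate i 0))))) (R.zeroˡ _))

    ∂-unit-≡ : ∀ (u : Fin n) a → ∂ u ((a , unit u) ∷ []) ≋ const-poly a
    ∂-unit-≡ u a = ≋-ext λ g → R.+-congʳ (R.*-cong
      (R.trans (R.reflexive (≡.cong (_×ᴷ a) (Vec.lookup∘update u 𝟎 1))) (R.+-identityʳ a))
      (R.reflexive (≡.cong g predecessor)))
      where
      predecessor : unit u Vec.[ u ]%= ℕ.pred ≡ 𝟎
      predecessor = ≡.trans (Vec.updateAt-updateAt u 𝟎)
        (Vec.updateAt-id-local u 𝟎 (≡.sym (Vec.lookup-replicate u 0)))

    -- Membership in `D` for the graphic arrangement thereby says that θ u and θ v are congruent
    -- modulo x u - x v for every edge.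
    ⟪x-x⟫ : ∀ (θ : Fin n → S n) u v → θ ⟪ x u +ˢ -ˢ x v ⟫ ≋ θ u +ˢ -ˢ θ v
    ⟪x-x⟫ θ u v = begin
      sum (λ i → θ i *ˢ (∂ i (x u) +ˢ ∂ i (-ˢ x v)))
        ≈⟨ sum-cong-≋ {n} (λ i → Sᴿ.distribˡ (θ i) (∂ i (x u)) (∂ i (-ˢ x v))) ⟩
      sum (λ i → θ i *ˢ ∂ i (x u) +ˢ θ i *ˢ ∂ i (-ˢ x v))
        ≈⟨ ∑-distrib-+ (λ i → θ i *ˢ ∂ i (x u)) (λ i → θ i *ˢ ∂ i (-ˢ x v)) ⟩
      sum (λ i → θ i *ˢ ∂ i (x u)) +ˢ sum (λ i → θ i *ˢ ∂ i (-ˢ x v))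
        ≈⟨ Sᴿ.+-cong (component u R.1#) (component v (R.- R.1#)) ⟩
      θ u *ˢ 1ˢ +ˢ θ v *ˢ -ˢ 1ˢ
        ≈⟨ Sᴿ.+-cong (Sᴿ.*-identityʳ (θ u)) (Sᴿ.trans (Sᴿ.sym (-‿distribʳ-* (θ v) 1ˢ))
             (Sᴿ.-‿cong (Sᴿ.*-identityʳ (θ v)))) ⟩
      θ u +ˢ -ˢ θ v ∎
      where
      component : ∀ u a → sum (λ i → θ i *ˢ ∂ i ((a , unit u) ∷ [])) ≋ θ u *ˢ const-poly a
      component u a = Sᴿ.trans
        (sum-select (λ i → θ i *ˢ ∂ i ((a , unit u) ∷ [])) u
          (λ i i≢u → Sᴿ.trans (*ˢ-congˡ (θ i) (∂-unit-≢ a i≢u)) (Sᴿ.zeroʳ (θ i))))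
        (*ˢ-congˡ (θ u) (∂-unit-≡ u a))

-- The maps between S and T

∈-zeros⁻ : ∀ {n} (a : Vec ℕ n) {v} → v ∈ zeros a → Vec.lookup a v ≡ 0
∈-zeros⁻ (zero  ∷ a) here       = ≡.refl
∈-zeros⁻ (_     ∷ a) (there v∈) = ∈-zeros⁻ a v∈

∈-zeros⁺ : ∀ {n} (a : Vec ℕ n) {v} → Vec.lookup a v ≡ 0 → v ∈ zeros a
∈-zeros⁺ (zero ∷ a) {zero}  eq = here
∈-zeros⁺ (_    ∷ a) {suc v} eq = there (∈-zeros⁺ a eq)

-- The component count is abstracted to any `γ` satisfying `γ-correct`, so the way `c` computes it
-- stays hidden in the construction.
module Basis {k ℓ₁ ℓ₂ : Level} (K : HeytingField k ℓ₁ ℓ₂) (ℓ : ℕ) (G : SimpleGraph (Fin ℓ))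
  (γ : Subset ℓ → ℕ) (γ-correct : ∀ W → HasComponentCount (induced G W) (γ W)) (d : ℕ) where

  open SimpleGraph G using (Adj)
  open Polynomials K
  open PolynomialMaps K
  open Logarithmic K ℓ using (Der; DerModule; DerDegree; D; graphicArrangement)
  open LeftModule DerModule using (_≈ᴹ_; _+ᴹ_; _*ₗ_; 0ᴹ; +ᴹ-commutativeMonoid)
  open import Algebra.Properties.CommutativeMonoid.Sum +ᴹ-commutativeMonoid using () renaming
    (sum to sumᴹ)
  open import Algebra.Properties.CommutativeMonoid.Sum R.+-commutativeMonoid using (sum; sum-cong-≋)
  open ListSum R.commutativeSemiring

  y : Fin ℓ → S (suc ℓ)
  y w = x (suc w)

  ψ-point : Fin ℓ → S (suc ℓ)
  ψ-point w = x zero +ˢ -ˢ y w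

  φ-point : Fin ℓ → Fin (suc ℓ) → S ℓ
  φ-point v zero    = x v
  φ-point v (suc w) = x v +ˢ -ˢ x w

  ψ : S ℓ → S (suc ℓ)
  ψ = substitute ψ-point

  ψ-hom : IsHom (polynomialRing ℓ) (polynomialRing (suc ℓ)) ψ
  ψ-hom = substitute-hom ψ-point

  module ψ = RingMorphisms.IsRingHomomorphism ψ-hom

  φ : Fin ℓ → S (suc ℓ) → S ℓ
  φ v = substitute (φ-point v)

  ψ-minus : ∀ p q → ψ (p +ˢ -ˢ q) ≋ ψ p +ˢ -ˢ ψ q
  ψ-minus p q = Sᴿ.trans (ψ.+-homo p (-ˢ q)) (Sᴿ.+-congˡ (ψ.-‿homo q))

  φ-minus : ∀ v p q → φ v (p +ˢ -ˢ q) ≋ φ v p +ˢ -ˢ φ v q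
  φ-minus v p q = Sᴿ.trans (+-homo p (-ˢ q)) (Sᴿ.+-congˡ (-‿homo q))
    where open RingMorphisms.IsRingHomomorphism (substitute-hom (φ-point v))

  φ-ψ : ∀ v p → φ v (ψ p) ≋ p
  φ-ψ v p = Sᴿ.trans (substitute-∘ (φ-point v) ψ-point p)
    (Sᴿ.trans (substitute-cong point p) (substitute-id p))
    where
    point : ∀ w → φ v (ψ-point w) ≋ x w
    point w = Sᴿ.trans (φ-minus v (x zero) (y w)) (Sᴿ.trans
      (Sᴿ.+-cong (substitute-x (φ-point v) zero) (Sᴿ.-‿cong (substitute-x (φ-point v) (suc w))))
      (x-[x-y]≈y (polynomialRing ℓ) (x v) (x w)))

  -- For `m = b ∷ a` this is x_v^b ∏_w (x_v - x_w)^(a_w). If a_v is positive, the factor x_v - x_v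
  -- makes it zero.
  P : Vec ℕ (suc ℓ) → Fin ℓ → S ℓ
  P m v = monomial (polynomialRing ℓ) (φ-point v) m

  -- P m v is φ v (X^ m), and ψ ∘ φ v is the identity modulo y v.
  coeff-ψ-P : ∀ v m m′ → Vec.lookup m′ (suc v) ≡ 0 → coeff (ψ (P m v)) m′ R.≈ δ m′ m
  coeff-ψ-P v m m′ m′ᵥ≡0 = begin
    coeff (ψ (P m v)) m′
      ≈⟨ coeff-≈ (proj₂ ψP~X^) m′ ⟩
    coeff (X^ m +ˢ r *ˢ y v) m′
      ≈⟨ coeff-+ (X^ m) (r *ˢ y v) m′ ⟩
    coeff (X^ m) m′ R.+ coeff (r *ˢ y v) m′
      ≈⟨ R.+-cong (coeff-X^ m m′) (coeff-*x r (suc v) m′ m′ᵥ≡0) ⟩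
    δ m′ m R.+ R.0#
      ≈⟨ R.+-identityʳ _ ⟩
    δ m′ m ∎
    where
    open import Relation.Binary.Reasoning.Setoid R.setoid
    open Congruence (polynomialRing (suc ℓ)) (y v)

    z-y~z : ψ-point v ~ x zero
    z-y~z = -ˢ 1ˢ , Sᴿ.+-congˡ {x = x zero}
      (Sᴿ.trans (Sᴿ.-‿cong (Sᴿ.sym (Sᴿ.*-identityˡ (y v)))) (-‿distribˡ-* 1ˢ (y v)))
      where
      open import Algebra.Properties.Ring (CommutativeRing.ring (polynomialRing (suc ℓ))) using
        (-‿distribˡ-*)

    point~ : ∀ i → ψ (φ-point v i) ~ x i
    point~ zero    = ~-resp (substitute-x ψ-point v) Sᴿ.refl z-y~z
    -- Modulo y_v, the image (z - y_v) - (z - y_w) is congruent to z - (z - y_w) = y_w.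
    point~ (suc w) = ~-resp
      (Sᴿ.trans (ψ-minus (x v) (x w)) (Sᴿ.+-cong (substitute-x ψ-point v)
        (Sᴿ.-‿cong (substitute-x ψ-point w))))
      (Sᴿ.sym (x-[x-y]≈y (polynomialRing (suc ℓ)) (x zero) (y w)))
      (+-cong-~ {ψ-point v} {x zero} z-y~z (~-reflexive (Sᴿ.refl {x = -ˢ ψ-point w})))

    ψP~X^ : ψ (P m v) ~ X^ m
    ψP~X^ = ~-resp (monomial-homo (polynomialRing ℓ) (polynomialRing (suc ℓ)) ψ ψ-hom (φ-point v) m)
                   (Sᴿ.sym (monomial-x m)) (monomial-cong-~ point~ m)

    r = proj₁ ψP~X^

  φ-point-linear : ∀ v i → AllOfDegree 1 (φ-point v i)
  φ-point-linear v zero    = AllOfDegree-x v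
  φ-point-linear v (suc w) = All.++⁺ (AllOfDegree-x v) (AllOfDegree-neg (AllOfDegree-x w))

  ψ-point-linear : ∀ w → AllOfDegree 1 (ψ-point w)
  ψ-point-linear w = All.++⁺ (AllOfDegree-x zero) (AllOfDegree-neg (AllOfDegree-x (suc w)))

  -- The basis vectors and their dual functionals

  κ : ∀ W → ∃ (_∈ W) → Fin (γ W)
  κ W = proj₁ (γ-correct W)

  κ-surjective : ∀ W j → ∃ λ v → κ W v ≡ j
  κ-surjective W = proj₁ (proj₂ (γ-correct W))

  κ-kernel : ∀ W u v → κ W u ≡ κ W v → Star (SimpleGraph.Adj (induced G W)) u v
  κ-kernel W u v = Equivalence.to (proj₂ (proj₂ (γ-correct W)) u v)

  κ-adjacent : ∀ W u v → Adj (proj₁ u) (proj₁ v) → κ W u ≡ κ W v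
  κ-adjacent W u v uv = Equivalence.from (proj₂ (proj₂ (γ-correct W)) u v) (uv ◅ ε)

  -- Extended by zero outside `W`, so that `basis` can be written at every vertex without a
  -- membership proof.
  indicator : ∀ W → Fin (γ W) → Fin ℓ → R.Carrier
  indicator W j v with v Subset.∈? W
  ... | yes v∈ = if does (κ W (v , v∈) Fin.≟ j) then R.1# else R.0#
  ... | no _   = R.0#

  indicator-≡ : ∀ W j {v} (v∈ : v ∈ W) → κ W (v , v∈) ≡ j → indicator W j v ≡ R.1#
  indicator-≡ W j {v} v∈ eq with v Subset.∈? W
  ... | no v∉   = contradiction v∈ v∉
  -- `κ` takes a membership proof; such proofs are unique, so the one found by the decision can be
  -- replaced by the given one.
  ... | yes v∈′ rewrite Vec.[]=-irrelevant v∈′ v∈ =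
    ≡.cong (if_then R.1# else R.0#) (dec-true (κ W (v , v∈) Fin.≟ j) eq)

  indicator-≢ : ∀ W j {v} (v∈ : v ∈ W) → κ W (v , v∈) ≢ j → indicator W j v ≡ R.0#
  indicator-≢ W j {v} v∈ ≢ with v Subset.∈? W
  ... | no v∉   = ≡.refl
  ... | yes v∈′ rewrite Vec.[]=-irrelevant v∈′ v∈ =
    ≡.cong (if_then R.1# else R.0#) (dec-false (κ W (v , v∈) Fin.≟ j) ≢)

  indicator-∉ : ∀ W j {v} → v ∉ W → indicator W j v ≡ R.0#
  indicator-∉ W j {v} v∉ with v Subset.∈? W
  ... | no _   = ≡.refl
  ... | yes v∈ = contradiction v∈ v∉

  indicator-adjacent : ∀ W j {u v} → u ∈ W → v ∈ W → Adj u v → indicator W j u ≡ indicator W j v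
  indicator-adjacent W j {u} {v} u∈ v∈ uv with κ W (u , u∈) Fin.≟ j
  ... | yes eq = ≡.trans (indicator-≡ W j u∈ eq)
    (≡.sym (indicator-≡ W j v∈ (≡.trans (≡.sym (κ-adjacent W (u , u∈) (v , v∈) uv)) eq)))
  ... | no ≢   = ≡.trans (indicator-≢ W j u∈ ≢)
    (≡.sym (indicator-≢ W j v∈ (≢ ∘ ≡.trans (κ-adjacent W (u , u∈) (v , v∈) uv))))

  Index : Set
  Index = ∃ λ (a : Vec ℕ ℓ) → Fin (γ (zeros a))

  -- The exponent of z is forced by the degree. The subtraction is truncated, so the total is `d`
  -- only for `a` with sum at most `d`, as holds throughout `indices`.
  homogenize : Vec ℕ ℓ → Vec ℕ (suc ℓ)
  homogenize a = d ∸ Vec.sum a ∷ a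

  basis : Index → Der
  basis (a , j) v = indicator (zeros a) j v ·ˢ P (homogenize a) v

  representative : ((a , j) : Index) → ∃ (_∈ zeros a)
  representative (a , j) = proj₁ (κ-surjective (zeros a) j)

  -- One representative per component suffices: by `constant`, all its vertices read the same
  -- coefficient of a logarithmic derivation of degree `d`.
  functional : Index → Der → R.Carrier
  functional e@(a , j) θ = coeff (ψ (θ (proj₁ (representative e)))) (homogenize a)

  coeff-ψ-· : ∀ r p m → coeff (ψ (r ·ˢ p)) m R.≈ r R.* coeff (ψ p) m
  coeff-ψ-· r p m = R.trans
    (coeff-≈ (Sᴿ.trans (Polynomial.lin-· (suc ℓ) ℓ _ r p) (const-poly-*ˢ r (ψ p))) m)
    (coeff-· r (ψ p) m)

  functional-basis : ∀ e e′ → functional e (basis e′) R.≈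
    indicator (zeros (proj₁ e′)) (proj₂ e′) (proj₁ (representative e)) R.*
    δ (homogenize (proj₁ e)) (homogenize (proj₁ e′))
  functional-basis e@(a , j) (a′ , j′) = R.trans
    (coeff-ψ-· _ (P (homogenize a′) v) (homogenize a))
    (R.*-congˡ (coeff-ψ-P v (homogenize a′) (homogenize a) (∈-zeros⁻ a v∈)))
    where
    v  = proj₁ (representative e)
    v∈ = proj₂ (representative e)

  functional-basis-≡ : ∀ e → functional e (basis e) R.≈ R.1#
  functional-basis-≡ e@(a , j) = R.trans (functional-basis e e) (R.trans
    (R.*-cong (R.reflexive (indicator-≡ (zeros a) j (proj₂ (representative e))
      (proj₂ (κ-surjective (zeros a) j))))
              (R.reflexive (δ-≡ (homogenize a))))
    (R.*-identityʳ R.1#))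

  -- Different exponent vectors are separated by `δ`. Over the same one, the representative of one
  -- component lies outside the other, so the indicator is zero.
  functional-basis-≢ : ∀ e e′ → e′ ≢ e → functional e (basis e′) R.≈ R.0#
  functional-basis-≢ e@(a , j) e′@(a′ , j′) e′≢e with a′ ≟ᵐ a
  ... | no a′≢a    = R.trans (functional-basis e e′) (R.trans
    (R.*-congˡ (R.reflexive (δ-≢ {m = homogenize a} {homogenize a′} (a′≢a ∘ ≡.cong Vec.tail))))
      (R.zeroʳ _))
  ... | yes ≡.refl = R.trans (functional-basis e e′) (R.trans
    (R.*-congʳ (R.reflexive (indicator-≢ (zeros a) j′ (proj₂ (representative e))
      λ eq → e′≢e (≡.cong (a ,_) (≡.trans (≡.sym eq) (proj₂ (κ-surjective (zeros a) j)))))))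
    (R.zeroˡ _))

  fibre : Vec ℕ ℓ → List Index
  fibre a = List.map (a ,_) (allFin (γ (zeros a)))

  indices : List Index
  indices = List.concatMap fibre (exponents ℓ d)

  length-indices : List.length indices ≡
    ListSum.∑ ℕ.+-*-commutativeSemiring (γ ∘ zeros) (exponents ℓ d)
  length-indices = go (exponents ℓ d)
    where
    go : ∀ as → List.length (List.concatMap fibre as) ≡
      ListSum.∑ ℕ.+-*-commutativeSemiring (γ ∘ zeros) as
    go []       = ≡.refl
    go (a ∷ as) = ≡.trans (List.length-++ (fibre a)) (≡.cong₂ ℕ._+_
      (≡.trans (List.length-map {B = Index} (a ,_) (allFin (γ (zeros a))))
        (List.length-tabulate {n = γ (zeros a)} id))
      (go as))

  indices-unique : Unique indices
  indices-unique = Unique.concat⁺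
    (All.map⁺ (All.universal (λ a → Unique.map⁺ (λ { ≡.refl → ≡.refl })
      (Unique.allFin⁺ (γ (zeros a)))) (exponents ℓ d)))
    (AllPairs.map⁺ (AllPairs.map disjoint (exponents-unique ℓ d)))
    where
    disjoint : ∀ {a a′} → a ≢ a′ → ∀ {e} →
               ¬ (e ∈ₗ fibre a × e ∈ₗ fibre a′)
    disjoint {a} {a′} a≢a′ (e∈ , e∈′) with ∈ₗ.∈-map⁻ (a ,_) e∈ | ∈ₗ.∈-map⁻ (a′ ,_) e∈′
    ... | _ , _ , ≡.refl | _ , _ , eq = a≢a′ (≡.cong proj₁ eq)

  ∈-indices⁻ : ∀ {e} → e ∈ₗ indices → proj₁ e ∈ₗ exponents ℓ d
  ∈-indices⁻ e∈ with find (∈ₗ.∈-concatMap⁻ fibre {xs = exponents ℓ d} e∈)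
  ... | a , a∈ , e∈′ with ∈ₗ.∈-map⁻ (a ,_) e∈′
  ...   | _ , _ , ≡.refl = a∈

  additive-sum : (h : Der → R.Carrier) → h 0ᴹ R.≈ R.0# → (∀ θ η → h (θ +ᴹ η) R.≈ h θ R.+ h η) →
                 ∀ {n} (θ : Fin n → Der) → h (sumᴹ θ) R.≈ sum (h ∘ θ)
  additive-sum h h-0 h-+ {zero}  θ = h-0
  additive-sum h h-0 h-+ {suc n} θ =
    R.trans (h-+ (θ zero) _) (R.+-congˡ (additive-sum h h-0 h-+ (θ ∘ suc)))

  functional-cong : ∀ e {θ η} → θ ≈ᴹ η → functional e θ R.≈ functional e η
  functional-cong e {θ} {η} eq =
    coeff-≈ (ψ.⟦⟧-cong {θ v} {η v} (mk (eq v))) (homogenize (proj₁ e))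
    where v = proj₁ (representative e)

  functional-sum : ∀ e {n} (a : Fin n → R.Carrier) (θ : Fin n → Der) →
                   functional e (sumᴹ (λ i → a i *ₗ θ i)) R.≈ sum (λ i → a i R.* functional e (θ i))
  functional-sum e a θ = R.trans
    (additive-sum (functional e) R.refl
      (λ η ζ → R.trans (coeff-≈ (ψ.+-homo (η v) (ζ v)) m) (coeff-+ (ψ (η v)) (ψ (ζ v)) m))
      (λ i → a i *ₗ θ i))
    (sum-cong-≋ (λ i → coeff-ψ-· (a i) (θ i v) m))
    where
    v = proj₁ (representative e)
    m = homogenize (proj₁ e)

  coeff-sum : ∀ v m {n} (a : Fin n → R.Carrier) (θ : Fin n → Der) →
              coeff (sumᴹ (λ i → a i *ₗ θ i) v) m R.≈ sum (λ i → a i R.* coeff (θ i v) m)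
  coeff-sum v m a θ = R.trans
    (additive-sum (λ θ → coeff (θ v) m) R.refl (λ η ζ → coeff-+ (η v) (ζ v) m) (λ i → a i *ₗ θ i))
    (sum-cong-≋ (λ i → coeff-· (a i) (θ i v) m))

  basisVector : Fin (List.length indices) → Der
  basisVector i = basis (List.lookup indices i)

  -- The functionals are dual to the vectors, so applying the one at index `i` to the relation
  -- leaves only `a i`.
  independent : ∀ (a : Fin (List.length indices) → R.Carrier) →
                sumᴹ (λ i → a i *ₗ basisVector i) ≈ᴹ 0ᴹ → ∀ i → a i R.≈ R.0#
  independent a eq i = begin
    a i
      ≈⟨ R.sym (R.trans (R.*-congˡ (functional-basis-≡ e)) (R.*-identityʳ _)) ⟩
    a i R.* functional e (basisVector i)
      ≈⟨ R.sym (sum-select (λ i′ → a i′ R.* functional e (basisVector i′)) i λ i′ i′≢i → R.trans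
           (R.*-congˡ (functional-basis-≢ e (List.lookup indices i′)
             (i′≢i ∘ lookup-injective indices-unique i′ i)))
           (R.zeroʳ _)) ⟩
    sum (λ i′ → a i′ R.* functional e (basisVector i′))
      ≈⟨ R.sym (functional-sum e a basisVector) ⟩
    functional e (sumᴹ (λ i → a i *ₗ basisVector i))
      ≈⟨ functional-cong e {sumᴹ (λ i → a i *ₗ basisVector i)} {0ᴹ} eq ⟩
    R.0# ∎
    where
    open import Relation.Binary.Reasoning.Setoid R.setoid
    e = List.lookup indices i

  -- The basis vectors are logarithmic of degree `d`

  P-zero : ∀ a {v} → v ∉ zeros a → P (homogenize a) v ≋ 0ˢ
  P-zero a {v} v∉ = monomial-zero (polynomialRing ℓ) (φ-point v) (suc v) (homogenize a)
    (v∉ ∘ ∈-zeros⁺ a) (Sᴿ.-‿inverseʳ (x v))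

  -- The points `φ-point u` and `φ-point v` agree modulo x u - x v, hence so do `P m u` and `P m v`;
  -- only the indicators could differ. For both ends in `W` the edge puts them in one component. If
  -- an end lies outside `W`, its `P` is zero, so its scalar may be exchanged for that of the other
  -- end.
  basis-logarithmic : ∀ e → D (graphicArrangement G) (basis e)
  basis-logarithmic e@(a , j) (u , v , uv) =
    let q , eq = ~⇒∣- (compare (u Subset.∈? W) (v Subset.∈? W)) in
    q , coeff-≈ (Sᴿ.trans (⟪x-x⟫ (basis e) u v) eq)
    where
    open Congruence (polynomialRing ℓ) (x u +ˢ -ˢ x v)

    xᵤ~xᵥ : x u ~ x v
    xᵤ~xᵥ = 1ˢ , Sᴿ.sym (Sᴿ.trans (Sᴿ.+-congˡ {x = x v} (Sᴿ.*-identityˡ (x u +ˢ -ˢ x v)))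
      (Sᴿ.trans (Sᴿ.sym (Sᴿ.+-assoc (x v) (x u) (-ˢ x v))) (xyx⁻¹≈y (x v) (x u))))
      where
      open import Algebra.Properties.AbelianGroup (CommutativeRing.+-abelianGroup
        (polynomialRing ℓ)) using (xyx⁻¹≈y)

    point~ : ∀ i → φ-point u i ~ φ-point v i
    point~ zero    = xᵤ~xᵥ
    point~ (suc w) = +-cong-~ {x u} {x v} xᵤ~xᵥ (~-reflexive (Sᴿ.refl {x = -ˢ x w}))

    W = zeros a
    m = homogenize a

    scaled~ : ∀ r → r ·ˢ P m u ~ r ·ˢ P m v
    scaled~ r = ~-resp (Sᴿ.sym (const-poly-*ˢ r (P m u))) (Sᴿ.sym (const-poly-*ˢ r (P m v)))
      (*-cong-~ {const-poly r} {const-poly r} (~-reflexive Sᴿ.refl) (monomial-cong-~ point~ m))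

    scaled-zero : ∀ r {w} → w ∉ W → r ·ˢ P m w ≋ 0ˢ
    scaled-zero r {w} w∉ = Sᴿ.trans (Sᴿ.sym (const-poly-*ˢ r (P m w)))
      (Sᴿ.trans (*ˢ-congˡ (const-poly r) (P-zero a w∉)) (Sᴿ.zeroʳ (const-poly r)))

    compare : Dec (u ∈ W) → Dec (v ∈ W) → basis e u ~ basis e v
    compare _        (no v∉)  = ~-resp Sᴿ.refl
      (Sᴿ.trans (scaled-zero (indicator W j v) v∉) (Sᴿ.sym (scaled-zero (indicator W j u) v∉)))
      (scaled~ (indicator W j u))
    compare (no u∉)  (yes _)  = ~-resp
      (Sᴿ.trans (scaled-zero (indicator W j u) u∉) (Sᴿ.sym (scaled-zero (indicator W j v) u∉)))
      Sᴿ.refl (scaled~ (indicator W j v))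
    compare (yes u∈) (yes v∈) = ~-resp Sᴿ.refl
      (Sᴿ.reflexive (≡.cong (_·ˢ P m v) (≡.sym (indicator-adjacent W j u∈ v∈ uv))))
      (scaled~ (indicator W j u))

  sum-homogenize : ∀ {a} → a ∈ₗ exponents ℓ d → Vec.sum (homogenize a) ≡ d
  sum-homogenize a∈ = ℕ.m∸n+n≡m (∈-exponents⁻ d a∈)

  basis-homogeneous : ∀ {e} → e ∈ₗ indices → DerDegree d (basis e)
  basis-homogeneous {a , j} e∈ v = AllOfDegree⇒IsHomogeneous {p = basis (a , j) v}
    (All.map⁺ (≡.subst (λ n → AllOfDegree n (P (homogenize a) v)) (sum-homogenize (∈-indices⁻ e∈))
      (AllOfDegree-monomial (φ-point-linear v) (homogenize a))))

  -- Every logarithmic derivation of degree `d` is a combination of the basis vectors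

  module _ (θ : Der) (θ-logarithmic : D (graphicArrangement G) θ)
    (θ-homogeneous : DerDegree d θ) where

    constant : ∀ a (u v : ∃ (_∈ zeros a)) → Star (SimpleGraph.Adj (induced G (zeros a))) u v →
               coeff (ψ (θ (proj₁ u))) (homogenize a) R.≈ coeff (ψ (θ (proj₁ v))) (homogenize a)
    constant a u v ε = R.refl
    constant a (u , u∈) v (_◅_ {j = w , w∈} uw path) = R.trans step (constant a (w , w∈) v path)
      where
      m = homogenize a
      q = proj₁ (θ-logarithmic (u , w , uw))

      -- Split into a multiple of y w and a multiple of y u, so that `coeff-*x` kills each part at
      -- an exponent where both variables are absent.
      difference : ψ (θ u) +ˢ -ˢ ψ (θ w) ≋ ψ q *ˢ y w +ˢ (-ˢ ψ q) *ˢ y u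
      difference = begin
        ψ (θ u) +ˢ -ˢ ψ (θ w)
          ≈⟨ Sᴿ.sym (ψ-minus (θ u) (θ w)) ⟩
        ψ (θ u +ˢ -ˢ θ w)
          ≈⟨ ψ.⟦⟧-cong {θ u +ˢ -ˢ θ w} {q *ˢ (x u +ˢ -ˢ x w)}
               (Sᴿ.trans (Sᴿ.sym (⟪x-x⟫ θ u w)) (mk (proj₂ (θ-logarithmic (u , w , uw))))) ⟩
        ψ (q *ˢ (x u +ˢ -ˢ x w))
          ≈⟨ ψ.*-homo q (x u +ˢ -ˢ x w) ⟩
        ψ q *ˢ ψ (x u +ˢ -ˢ x w)
          ≈⟨ *ˢ-congˡ (ψ q) (Sᴿ.trans (ψ-minus (x u) (x w))
               (Sᴿ.+-cong (substitute-x ψ-point u) (Sᴿ.-‿cong (substitute-x ψ-point w)))) ⟩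
        ψ q *ˢ (ψ-point u +ˢ -ˢ ψ-point w)
          ≈⟨ *ˢ-congˡ (ψ q) ([z-x]-[z-y]≈y-x (polynomialRing (suc ℓ)) (y u) (y w) (x zero)) ⟩
        ψ q *ˢ (y w +ˢ -ˢ y u)
          ≈⟨ Sᴿ.distribˡ (ψ q) (y w) (-ˢ y u) ⟩
        ψ q *ˢ y w +ˢ ψ q *ˢ (-ˢ y u)
          ≈⟨ Sᴿ.+-congˡ {x = ψ q *ˢ y w} (Sᴿ.trans (Sᴿ.sym (-‿distribʳ-* (ψ q) (y u)))
               (-‿distribˡ-* (ψ q) (y u))) ⟩
        ψ q *ˢ y w +ˢ (-ˢ ψ q) *ˢ y u ∎
        where
        open import Relation.Binary.Reasoning.Setoid
          (CommutativeRing.setoid (polynomialRing (suc ℓ)))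
        open import Algebra.Properties.Ring (CommutativeRing.ring (polynomialRing (suc ℓ))) using
          (-‿distribˡ-*; -‿distribʳ-*)

      step : coeff (ψ (θ u)) m R.≈ coeff (ψ (θ w)) m
      step = x∙y⁻¹≈ε⇒x≈y _ _ (begin
        coeff (ψ (θ u)) m R.- coeff (ψ (θ w)) m
          ≈⟨ R.+-congˡ (R.sym (coeff-neg (ψ (θ w)) m)) ⟩
        coeff (ψ (θ u)) m R.+ coeff (-ˢ ψ (θ w)) m
          ≈⟨ R.sym (coeff-+ (ψ (θ u)) (-ˢ ψ (θ w)) m) ⟩
        coeff (ψ (θ u) +ˢ -ˢ ψ (θ w)) m
          ≈⟨ coeff-≈ difference m ⟩
        coeff (ψ q *ˢ y w +ˢ (-ˢ ψ q) *ˢ y u) m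
          ≈⟨ coeff-+ (ψ q *ˢ y w) ((-ˢ ψ q) *ˢ y u) m ⟩
        coeff (ψ q *ˢ y w) m R.+ coeff ((-ˢ ψ q) *ˢ y u) m
          ≈⟨ R.+-cong (coeff-*x (ψ q) (suc w) m (∈-zeros⁻ a w∈))
               (coeff-*x (-ˢ ψ q) (suc u) m (∈-zeros⁻ a u∈)) ⟩
        R.0# R.+ R.0#
          ≈⟨ R.+-identityʳ R.0# ⟩
        R.0# ∎)
        where
        open import Relation.Binary.Reasoning.Setoid R.setoid
        open import Algebra.Properties.Ring R.ring using (x∙y⁻¹≈ε⇒x≈y)

    functional-∈ : ∀ a {v} (v∈ : v ∈ zeros a) →
                   functional (a , κ (zeros a) (v , v∈)) θ R.≈ coeff (ψ (θ v)) (homogenize a)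
    functional-∈ a {v} v∈ = constant a (representative e) (v , v∈)
      (κ-kernel (zeros a) _ _ (proj₂ (κ-surjective (zeros a) (proj₂ e))))
      where
      e : Index
      e = a , κ (zeros a) (v , v∈)

    component : Fin ℓ → Vec ℕ ℓ → Index → R.Carrier
    component v m e = functional e θ R.* coeff (basis e v) m

    -- For `v` in `zeros a` only the component of `v` has a nonzero indicator at `v`. Otherwise both
    -- sides vanish, the left one by the indicators and the right one by `P-zero`.
    component-fibre : ∀ v m a → ∑ (component v m) (fibre a) R.≈
                      coeff (ψ (θ v)) (homogenize a) R.* coeff (P (homogenize a) v) m
    component-fibre v m a = go (v Subset.∈? zeros a)
      where
      scaled-0 : ∀ {j} → indicator (zeros a) j v ≡ R.0# → component v m (a , j) R.≈ R.0#
      scaled-0 eq = R.trans (R.*-congˡ (R.trans (coeff-· _ (P (homogenize a) v) m)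
        (R.trans (R.*-congʳ (R.reflexive eq)) (R.zeroˡ _)))) (R.zeroʳ _)

      go : Dec (v ∈ zeros a) → ∑ (component v m) (fibre a) R.≈
           coeff (ψ (θ v)) (homogenize a) R.* coeff (P (homogenize a) v) m
      go (no v∉) = R.trans
        (∑-zero (fibre a) λ e∈ → vanish (proj₂ (proj₂ (∈ₗ.∈-map⁻ (a ,_) e∈))))
        (R.sym (R.trans (R.*-congˡ (coeff-≈ (P-zero a v∉) m)) (R.zeroʳ _)))
        where
        vanish : ∀ {e j} → e ≡ (a , j) → component v m e R.≈ R.0#
        vanish {j = j} ≡.refl = scaled-0 (indicator-∉ (zeros a) j v∉)
      go (yes v∈) = R.trans
        (∑-map (component v m) (a ,_) (allFin _))
        (R.trans
          (∑-select (λ j → component v m (a , j)) (Unique.allFin⁺ _)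
            (∈ₗ.∈-allFin (κ (zeros a) (v , v∈)))
            λ {j} _ j≢ → scaled-0 (indicator-≢ (zeros a) j v∈ (j≢ ∘ ≡.sym)))
          (R.*-cong (functional-∈ a v∈) (R.trans (coeff-· _ (P (homogenize a) v) m)
            (R.trans (R.*-congʳ (R.reflexive (indicator-≡ (zeros a) _ v∈ ≡.refl)))
              (R.*-identityˡ _)))))

    -- `ψ` preserves degree, and an exponent `b ∷ a` of total `d` is `homogenize a` with the sum of
    -- `a` at most `d`.
    ψθ-supported : ∀ v m → m ∉ₗ List.map homogenize (exponents ℓ d) → coeff (ψ (θ v)) m R.≈ R.0#
    ψθ-supported v m@(b ∷ a) m∉ =
      substitute-homogeneous ψ-point-linear (θ v) (θ-homogeneous v) m λ sum≡d →
        m∉ (≡.subst (_∈ₗ List.map homogenize (exponents ℓ d))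
          (≡.cong (_∷ a) (≡.trans (≡.cong (_∸ Vec.sum a) (≡.sym sum≡d)) (ℕ.m+n∸n≡m b (Vec.sum a))))
          (∈ₗ.∈-map⁺ homogenize (∈-exponents⁺ d a (≡.subst (Vec.sum a ≤_) sum≡d
            (ℕ.m≤n+m (Vec.sum a) b)))))

    -- This is θ_v = φ_v(ψ(θ_v)) expanded over the monomials of ψ(θ_v), whose images under φ_v are
    -- the polynomials `P`. Grouping the basis vectors by exponent vector turns their combination
    -- into that expansion.
    spanning : θ ≈ᴹ sumᴹ (λ i → functional (List.lookup indices i) θ *ₗ basisVector i)
    spanning v m = R.sym (begin
      coeff (sumᴹ (λ i → functional (List.lookup indices i) θ *ₗ basisVector i) v) m
        ≈⟨ coeff-sum v m (λ i → functional (List.lookup indices i) θ) basisVector ⟩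
      sum (λ i → component v m (List.lookup indices i))
        ≈⟨ ∑-lookup (component v m) indices ⟩
      ∑ (component v m) indices
        ≈⟨ ∑-concatMap (component v m) fibre (exponents ℓ d) ⟩
      ∑ (λ a → ∑ (component v m) (fibre a)) (exponents ℓ d)
        ≈⟨ ∑-cong (exponents ℓ d) (component-fibre v m) ⟩
      ∑ (λ a → coeff (ψ (θ v)) (homogenize a) R.* coeff (P (homogenize a) v) m) (exponents ℓ d)
        ≈⟨ R.sym (∑-map (λ m′ → coeff (ψ (θ v)) m′ R.* coeff (P m′ v) m) homogenize
             (exponents ℓ d)) ⟩
      ∑ (λ m′ → coeff (ψ (θ v)) m′ R.* coeff (P m′ v) m) (List.map homogenize (exponents ℓ d))
        ≈⟨ R.sym (lin-support (Unique.map⁺ (≡.cong Vec.tail) (exponents-unique ℓ d)) (ψ (θ v))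
             (ψθ-supported v) (λ m′ → coeff (P m′ v) m)) ⟩
      lin (λ m′ → coeff (P m′ v) m) (ψ (θ v))
        ≈⟨ R.sym (coeff-lin (λ m′ → P m′ v) (ψ (θ v)) m) ⟩
      coeff (φ v (ψ (θ v))) m
        ≈⟨ coeff-≈ (φ-ψ v (θ v)) m ⟩
      coeff (θ v) m ∎)
      where open import Relation.Binary.Reasoning.Setoid R.setoid

  hasDimension : HasDimension DerModule (D (graphicArrangement G) ∩ DerDegree d)
    (List.length indices)
  hasDimension = basisVector , record
    { member      = λ i → basis-logarithmic (List.lookup indices i) ,
                          basis-homogeneous (∈ₗ.∈-lookup i)
    ; independent = independent
    ; spanning    = λ {θ} (θ-logarithmic , θ-homogeneous) →
      _ , spanning θ θ-logarithmic θ-homogeneous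
    }

-- The Hilbert series

open PowerSeries using (t; 1/[1-t]; _·_; _*_; _^_; sum-series)

corollary7p14 : ∀ {k ℓ₁ ℓ₂} (K : HeytingField k ℓ₁ ℓ₂) (ℓ : ℕ) (G : SimpleGraph (Fin ℓ)) →
    let open Logarithmic K ℓ in
    HasHilbertSeries (D (graphicArrangement G))
    (∑[ i < ℓ ] ((+ f G (toℕ i)) · (t ^ toℕ i * 1/[1-t] ^ suc (toℕ i))))
corollary7p14 K ℓ G d =
  List.length B.indices , B.hasDimension ,
  ≡.trans (hilbert-coefficient G d) (≡.cong +_ (≡.sym B.length-indices))
  where module B = Basis K ℓ G (c G) (c-correct G) d
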